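{- Let $V$ be a finite subset of $\mathbb{Z}_{>0}$. For all $\pi\in\Pi_{\Gamma_V}$, we have that $(-1)^{|\pi|}\mu_{\Pi_{\Gamma_V}}(\hat0,\pi)$ equals the number of ID forests on $V$ whose trees have node sets equal to the blocks of $\pi$. Consequently, $-\mu_{\Pi_{\Gamma_V}}(\hat0,\hat1)$ is equal to the number of ID trees on $V$, and $$\chi_{\Pi_{\Gamma_V}}(t)=\sum_{k=1}^{|V|}(-1)^{k}\,|\mathcal{F}_{V,k}|\,t^{k-1},$$ where $\mathcal{F}_{V,k}$ is the set of ID forests on $V$ with exactly $k$ trees.
   Context: For a finite set $V\subset\mathbb{Z}_{>0}$, $\Gamma_V$ is the bipartite graph on vertex set $V$ with an edge $\{u,v\}$ for each $u<v$ in $V$ with $u$ odd and $v$ even. For a finite graph $G$ with vertex set $V$, the bond lattice $\Pi_G$ is the set of partitions $\pi$ of $V$ such that the induced subgraph of $G$ on each block is connected, ordered by: $\pi\le\pi'$ iff every block of $\pi$ is contained in a block of $\pi'$. Its minimum $\hat0$ is the partition into singletons, $\hat1$ is its maximum, and $|\pi|$ denotes the number of blocks of $\pi$. For a finite ranked poset $P$ of length $\ell$ with minimum $\hat0$, Möbius function $\mu_P$ and rank function $\mathrm{rk}$, the characteristic polynomial is $\chi_P(t)=\sum_{x\in P}\mu_P(\hat0,x)t^{\ell-\mathrm{rk}(x)}$. A tree $T$ with nodes in $\mathbb{Z}_{>0}$ is increasing-decreasing (ID) if, when $T$ is rooted at its largest node, each internal (i.e. non-leaf, having at least one child) node $v$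 satisfies: (1) if $v$ is odd then $v$ is less than all its descendants and all its children are even; (2) if $v$ is even then $v$ is greater than all its descendants and all its children are odd. (A single-node tree is an ID tree.) An ID forest on $V$ is a forest with node set $V$ each of whose components is an ID tree.
   Formalization: All three formulas carry an extra factor (-1)^{|V|} (as printed they fail for odd |V|, e.g. V={1}); the formulas for -μ(0̂,1̂) and χ assume Γ_V connected and V nonempty (they fail otherwise, e.g. V={1,3}). -}

module Defs where

open import Data.Bool.Base using (true; false; if_then_else_)
import Data.Bool.Properties as Bool
open import Data.Fin.Base using (Fin; zero; suc)
import Data.Fin.Induction as Fin
import Data.Fin.Properties as Fin
open import Data.Fin.Subset using (Subset; _∈_; _∉_; _⊆_; Nonempty; ⊤)
import Data.Fin.Subset.Properties as Subset
open import Data.Integer.Base as ℤ using (ℤ; 0ℤ; 1ℤ)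
open import Data.Irrelevant using ([_])
open import Data.List.Base as List using (List; []; _∷_; length; filter; foldr; deduplicate)
open import Data.List.Membership.Propositional using () renaming (_∈_ to _∈ₗ_)
open import Data.List.Membership.Propositional.Properties using (∈-cartesianProductWith⁺; ∈-lookup)
import Data.List.Membership.DecPropositional as DecMembership
open import Data.List.Relation.Unary.All as All using (All; []; _∷_)
open import Data.List.Relation.Unary.All.Properties using (¬Any⇒All¬)
open import Data.List.Relation.Unary.AllPairs using ([]; _∷_)
open import Data.List.Relation.Unary.Any as Any using (here; there)
open import Data.List.Relation.Unary.Any.Properties using (lookup-index)
open import Data.List.Relation.Unary.Unique.Propositional using (Unique)
import Data.List.Relation.Unary.Unique.DecPropositional as DecUnique
import Data.List.Relation.Unary.Unique.Propositional.Properties as Unique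
open import Data.Nat.Base as ℕ using (ℕ; zero; suc; _⊔_; _∸_; z≤n; s≤s)
open import Data.Nat.Divisibility using (_∣_; _∣?_)
import Data.Nat.Properties as ℕ
open import Data.Product.Base using (Σ; ∃; _×_; _,_; proj₁; proj₂)
open import Data.Refinement using (Refinement-syntax; value; value-injective) renaming (_,_ to _,ᵣ_)
import Data.Refinement as Refinement
open import Data.Unit.Base using (tt) renaming (⊤ to Unit)
open import Data.Sum.Base using (_⊎_; inj₁; inj₂; swap)
open import Data.Vec.Base as Vec using (Vec; []; _∷_; tabulate)
import Data.Vec.Properties as Vec
open import Function.Base using (_∘_; _on_; id)
open import Function.Bundles using (mk⇔)
open import Induction.WellFounded as WF using (WellFounded; module Subrelation)
open import Level using (0ℓ)
open import Relation.Binary.Construct.Closure.ReflexiveTransitive as Star using (Star; ε; _◅_; _◅◅_)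
import Relation.Binary.Construct.NonStrictToStrict as ToStrict
import Relation.Binary.Construct.On as On
open import Relation.Binary.Core using (Rel)
open import Relation.Binary.Definitions as B using (Minimum; Maximum; DecidableEquality; Symmetric; Irreflexive)
open import Relation.Binary.PropositionalEquality using (_≡_; _≢_; refl; sym; trans; cong; subst; subst₂; isEquivalence)
open import Relation.Binary.Structures using (IsEquivalence; IsDecPartialOrder)
open import Relation.Nullary using (¬_; Dec; yes; no; does)
open import Relation.Nullary.Decidable using (map′; ¬?; _×-dec_; _⊎-dec_; _→-dec_; recompute; dec-true; does-⇔)
open import Relation.Nullary.Negation using (contradiction)
open import Relation.Unary as U using (Pred)

record Enumeration (A : Set) : Set where
  field
    elements : List A
    complete : ∀ x → x ∈ₗ elements
    unique   : Unique elements

open Enumeration public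

#_∣_ : {A : Set} → Enumeration A → {P : Pred A 0ℓ} → U.Decidable P → ℕ
# e ∣ P? = length (filter P? (elements e))

module _ {A : Set} {P : Pred A 0ℓ} (P? : U.Decidable P) where

  refineList : List A → List [ x ∈ A ∣ P x ]
  refineList [] = []
  refineList (x ∷ xs) with P? x
  ... | yes p = (x ,ᵣ [ p ]) ∷ refineList xs
  ... | no _  = refineList xs

  ∈-refineList : ∀ {xs} (y : [ x ∈ A ∣ P x ]) → value y ∈ₗ xs → y ∈ₗ refineList xs
  ∈-refineList {x ∷ xs} (y ,ᵣ [ py ]) y∈ with P? x | y∈
  ... | yes _ | here eq  = here (value-injective eq)
  ... | yes _ | there y∈ = there (∈-refineList (y ,ᵣ [ py ]) y∈)
  ... | no ¬p | here refl = contradiction (recompute (P? y) py) ¬p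
  ... | no _  | there y∈ = ∈-refineList (y ,ᵣ [ py ]) y∈

  refineList-≢ : ∀ {x xs} (y : [ x ∈ A ∣ P x ]) → value y ≡ x →
                 All (x ≢_) xs → All (y ≢_) (refineList xs)
  refineList-≢ y eq [] = []
  refineList-≢ {xs = z ∷ zs} y eq (x≢z ∷ ps) with P? z
  ... | yes _ = (λ y≡z → x≢z (trans (sym eq) (cong value y≡z))) ∷ refineList-≢ y eq ps
  ... | no _  = refineList-≢ y eq ps

  refineList-! : ∀ {xs} → Unique xs → Unique (refineList xs)
  refineList-! [] = []
  refineList-! {x ∷ _} (x∉ ∷ xs!) with P? x
  ... | yes p = refineList-≢ (x ,ᵣ [ p ]) refl x∉ ∷ refineList-! xs!
  ... | no _  = refineList-! xs!

  refinements : Enumeration A → Enumeration [ x ∈ A ∣ P x ]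
  refinements e = record
    { elements = refineList (elements e)
    ; complete = λ y → ∈-refineList y (complete e (value y))
    ; unique   = refineList-! (unique e)
    }

vectors : {A : Set} → Enumeration A → ∀ n → Enumeration (Vec A n)
vectors e zero = record
  { elements = [] ∷ []
  ; complete = λ { [] → here refl }
  ; unique   = [] ∷ []
  }
vectors e (suc n) = record
  { elements = List.cartesianProductWith _∷_ (elements e) (elements es)
  ; complete = λ { (x ∷ xs) → ∈-cartesianProductWith⁺ _∷_ (complete e x) (complete es xs) }
  ; unique   = Unique.cartesianProductWith⁺ _∷_ Vec.∷-injective (unique e) (unique es)
  }
  where es = vectors e n

subsets : ∀ n → Enumeration (Subset n)
subsets = vectors record
  { elements = true ∷ false ∷ []
  ; complete = λ { true → here refl ; false → there (here refl) }
  ; unique   = ((λ ()) ∷ []) ∷ [] ∷ []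
  }

-- Integer polynomials in t, as coefficient sequences; equality is _≗_.
Poly : Set
Poly = ℕ → ℤ

infix 7 _·t^_
_·t^_ : ℤ → ℕ → Poly
(c ·t^ e) m = if does (e ℕ.≟ m) then c else 0ℤ

∑ℤ : {A : Set} → List A → (A → ℤ) → ℤ
∑ℤ xs f = foldr (λ x s → f x ℤ.+ s) 0ℤ xs

∑ₚ : {A : Set} → List A → (A → Poly) → Poly
∑ₚ xs f m = ∑ℤ xs (λ x → f x m)

record FinitePoset : Set₁ where
  field
    Carrier           : Set
    _≤_               : Rel Carrier 0ℓ
    isDecPartialOrder : IsDecPartialOrder _≡_ _≤_
    enumeration       : Enumeration Carrier
    0̂                 : Carrier
    0̂-minimum         : Minimum _≤_ 0̂

  open IsDecPartialOrder isDecPartialOrder public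
    using (_≟_; _≤?_; isPartialOrder)

  open ToStrict _≡_ _≤_ public using (_<_)

  _<?_ : B.Decidable _<_
  _<?_ = ToStrict.<-decidable _≡_ _≤_ _≟_ _≤?_

  <-wellFounded : WellFounded _<_
  <-wellFounded = Subrelation.wellFounded {_<₁_ = _<_} {_<₂_ = _⊏_ on index}
    (λ {x} {y} → subst₂ _<_ (lookup-index (complete enumeration x))
                            (lookup-index (complete enumeration y)))
    (On.wellFounded index (Fin.spo-wellFounded ⊏-spo))
    where
    xs = elements enumeration
    index : Carrier → Fin (length xs)
    index x = Any.index (complete enumeration x)
    _⊏_ = _<_ on List.lookup xs
    ⊏-spo = On.isStrictPartialOrder (List.lookup xs)
              (ToStrict.<-isStrictPartialOrder _≡_ _≤_ isPartialOrder)

  -- μ x x = 1 and μ x y = - Σ_{x ≤ z < y} μ x z for y ≠ x; thus μ x y = 0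
  -- unless x ≤ y.
  μ-term : ∀ x y → (∀ {z} → z < y → ℤ) → Carrier → ℤ
  μ-term x y μ[x,_] z with x ≤? z | z <? y
  ... | yes _ | yes z<y = μ[x, z<y ]
  ... | _     | _       = 0ℤ

  μ-step : ∀ x y → (∀ {z} → z < y → ℤ) → ℤ
  μ-step x y rec = if does (x ≟ y) then 1ℤ else ℤ.- ∑ℤ (elements enumeration) (μ-term x y rec)

  μ : Carrier → Carrier → ℤ
  μ x = WF.All.wfRec <-wellFounded 0ℓ (λ _ → ℤ) (μ-step x)

  -- The largest k with a chain x₀ < ⋯ < x_k = x; for a ranked poset this is
  -- the rank function.
  rk-term : ∀ y → (∀ {z} → z < y → ℕ) → Carrier → ℕ
  rk-term y rk[_] z with z <? y
  ... | yes z<y = suc rk[ z<y ]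
  ... | no _    = 0

  rk-step : ∀ y → (∀ {z} → z < y → ℕ) → ℕ
  rk-step y rec = foldr (λ z h → rk-term y rec z ⊔ h) 0 (elements enumeration)

  rk : Carrier → ℕ
  rk = WF.All.wfRec <-wellFounded 0ℓ (λ _ → ℕ) rk-step

  ℓ : ℕ
  ℓ = foldr (λ x h → rk x ⊔ h) 0 (elements enumeration)

  χ : Poly
  χ = ∑ₚ (elements enumeration) λ x → μ 0̂ x ·t^ (ℓ ∸ rk x)

lookup-injective : {A : Set} {xs : List A} → Unique xs →
                   ∀ {i j} → List.lookup xs i ≡ List.lookup xs j → i ≡ j
lookup-injective (_ ∷ _)  {zero}  {zero}  _  = refl
lookup-injective (x∉ ∷ _) {zero}  {suc j} eq = contradiction eq (All.lookup x∉ (∈-lookup j))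
lookup-injective (x∉ ∷ _) {suc i} {zero}  eq = contradiction (sym eq) (All.lookup x∉ (∈-lookup i))
lookup-injective (_ ∷ !)  {suc i} {suc j} eq = cong suc (lookup-injective ! eq)

module _ {n : ℕ} where

  visits : {E : Rel (Fin n) 0ℓ} → ∀ {u v} → Star E u v → List (Fin n)
  visits {v = v} ε = v ∷ []
  visits {u = u} (_ ◅ w) = u ∷ visits w

  Path : Rel (Fin n) 0ℓ → Rel (Fin n) 0ℓ
  Path E u v = Σ (Star E u v) (Unique ∘ visits)

  Induced : Rel (Fin n) 0ℓ → Subset n → Rel (Fin n) 0ℓ
  Induced E S u v = u ∈ S × v ∈ S × E u v

  ConnectedOn : Rel (Fin n) 0ℓ → Subset n → Set
  ConnectedOn E S = Nonempty S × (∀ u v → u ∈ S → v ∈ S → Star (Induced E S) u v)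

  Cycle : Rel (Fin n) 0ℓ → Set
  Cycle E = ∃ λ u → ∃ λ v → E v u × Σ (Path E u v) λ p → 3 ℕ.≤ length (visits (proj₁ p))

  Acyclic : Rel (Fin n) 0ℓ → Set
  Acyclic E = ¬ Cycle E

  IsTreeOn : Rel (Fin n) 0ℓ → Subset n → Set
  IsTreeOn E S = ConnectedOn E S × Acyclic (Induced E S)

  -- For a tree E rooted at r: v lies on the path from the root to w.
  Descendant : Rel (Fin n) 0ℓ → (r v w : Fin n) → Set
  Descendant E r v w = w ≢ v × Σ (Path E r w) λ p → v ∈ₗ visits (proj₁ p)

  Child : Rel (Fin n) 0ℓ → (r v w : Fin n) → Set
  Child E r v w = Descendant E r v w × E v w

  path-from : ∀ {E : Rel (Fin n) 0ℓ} {x u v} (w : Star E x v) → Unique (visits w) →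
              u ∈ₗ visits w → Path E u v
  path-from ε       !       (here refl) = ε , !
  path-from (e ◅ w) !       (here refl) = e ◅ w , !
  path-from (e ◅ w) (_ ∷ !) (there u∈)  = path-from w ! u∈

  walk⇒path : ∀ {E : Rel (Fin n) 0ℓ} {u v} → Star E u v → Path E u v
  walk⇒path ε = ε , [] ∷ []
  walk⇒path {u = u} (e ◅ w) with walk⇒path w
  ... | p , p! with DecMembership._∈?_ Fin._≟_ u (visits p)
  ...   | yes u∈p = path-from p p! u∈p
  ...   | no  u∉p = e ◅ p , ¬Any⇒All¬ _ u∉p ∷ p!

  induced? : ∀ {E} → B.Decidable E → ∀ S → B.Decidable (Induced E S)
  induced? E? S u v = u Subset.∈? S ×-dec v Subset.∈? S ×-dec E? u v

  module _ {E : Rel (Fin n) 0ℓ} (E? : B.Decidable E) where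

    boundedWalk? : ∀ k {Q : Pred (List (Fin n)) 0ℓ} → U.Decidable Q → ∀ u v →
                   Dec (Σ (Star E u v) λ w → length (visits w) ℕ.≤ k × Q (visits w))
    boundedWalk? zero Q? u v = no λ { (ε , () , _) ; (_ ◅ _ , () , _) }
    boundedWalk? (suc k) {Q} Q? u v =
      map′ from to
        ((u Fin.≟ v ×-dec Q? (u ∷ [])) ⊎-dec
         Fin.any? λ x → E? u x ×-dec boundedWalk? k (Q? ∘ (u ∷_)) x v)
      where
      from : _ → Σ (Star E u v) λ w → length (visits w) ℕ.≤ suc k × Q (visits w)
      from (inj₁ (refl , q)) = ε , s≤s z≤n , q
      from (inj₂ (x , e , w , l , q)) = e ◅ w , s≤s l , q
      to : Σ (Star E u v) (λ w → length (visits w) ℕ.≤ suc k × Q (visits w)) → _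
      to (ε , _ , q) = inj₁ (refl , q)
      to (e ◅ w , s≤s l , q) = inj₂ (_ , e , w , l , q)

    path? : ∀ {Q : Pred (List (Fin n)) 0ℓ} → U.Decidable Q → ∀ u v →
            Dec (Σ (Path E u v) λ p → Q (visits (proj₁ p)))
    path? Q? u v =
      map′ (λ { (w , _ , ! , q) → (w , !) , q })
           (λ { ((w , !) , q) → w , Fin.injective⇒≤ (lookup-injective !) , ! , q })
           (boundedWalk? n (λ l → DecUnique.unique? Fin._≟_ l ×-dec Q? l) u v)

    walk? : B.Decidable (Star E)
    walk? u v = map′ (proj₁ ∘ proj₁) (λ w → walk⇒path w , tt)
                     (path? {Q = λ _ → Unit} (λ _ → yes tt) u v)

    acyclic? : Dec (Acyclic E)
    acyclic? = ¬? (Fin.any? λ u → Fin.any? λ v → E? v u ×-dec path? (λ l → 3 ℕ.≤? length l) u v)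

    descendant? : ∀ r v w → Dec (Descendant E r v w)
    descendant? r v w = ¬? (w Fin.≟ v) ×-dec path? (DecMembership._∈?_ Fin._≟_ v) r w

    child? : ∀ r v w → Dec (Child E r v w)
    child? r v w = descendant? r v w ×-dec E? v w

  module _ {E : Rel (Fin n) 0ℓ} (E? : B.Decidable E) where

    connectedOn? : U.Decidable (ConnectedOn E)
    connectedOn? S = Subset.nonempty? S ×-dec
      Fin.all? λ u → Fin.all? λ v →
        (u Subset.∈? S) →-dec (v Subset.∈? S) →-dec walk? (induced? E? S) u v

    isTreeOn? : U.Decidable (IsTreeOn E)
    isTreeOn? S = connectedOn? S ×-dec acyclic? (induced? E? S)

-- The i-th entry of the vector is the block containing i.
IsPartition : ∀ {n} → Vec (Subset n) n → Set
IsPartition b = (∀ i → i ∈ Vec.lookup b i) ×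
                (∀ i j → j ∈ Vec.lookup b i → Vec.lookup b j ≡ Vec.lookup b i)

Partition : ℕ → Set
Partition n = [ b ∈ Vec (Subset n) n ∣ IsPartition b ]

_≟ˢ_ : ∀ {n} → DecidableEquality (Subset n)
_≟ˢ_ = Vec.≡-dec Bool._≟_

_≟ᵖ_ : ∀ {n} → DecidableEquality (Partition n)
_≟ᵖ_ = Refinement._≟_ (Vec.≡-dec _≟ˢ_)

isPartition? : ∀ {n} → U.Decidable (IsPartition {n})
isPartition? b =
  (Fin.all? λ i → i Subset.∈? Vec.lookup b i) ×-dec
  (Fin.all? λ i → Fin.all? λ j →
    (j Subset.∈? Vec.lookup b i) →-dec (Vec.lookup b j ≟ˢ Vec.lookup b i))

fromDec : ∀ {n} {P : Pred (Fin n) 0ℓ} → U.Decidable P → Subset n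
fromDec P? = tabulate (does ∘ P?)

∈-fromDec⁺ : ∀ {n} {P : Pred (Fin n) 0ℓ} (P? : U.Decidable P) {i} → P i → i ∈ fromDec P?
∈-fromDec⁺ P? {i} p = Vec.lookup⇒[]= i _ (trans (Vec.lookup∘tabulate _ i) (dec-true (P? i) p))

∈-fromDec⁻ : ∀ {n} {P : Pred (Fin n) 0ℓ} (P? : U.Decidable P) {i} → i ∈ fromDec P? → P i
∈-fromDec⁻ P? {i} i∈ with P? i | trans (sym (Vec.lookup∘tabulate (does ∘ P?) i)) (Vec.[]=⇒lookup i∈)
... | yes p | _ = p

module _ {n : ℕ} where

  block : Partition n → Fin n → Subset n
  block π = Vec.lookup (value π)

  ∣_∣ : Partition n → ℕ
  ∣ π ∣ = length (deduplicate _≟ˢ_ (Vec.toList (value π)))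

  _≤ᵖ_ : Rel (Partition n) 0ℓ
  π ≤ᵖ π′ = ∀ i → ∃ λ j → block π i ⊆ block π′ j

  _≤ᵖ?_ : B.Decidable _≤ᵖ_
  π ≤ᵖ? π′ = Fin.all? λ i → Fin.any? λ j → block π i Subset.⊆? block π′ j

  partition-correct : (π : Partition n) → IsPartition (value π)
  partition-correct (b ,ᵣ [ p ]) = recompute (isPartition? b) p

  ≤ᵖ⇒⊆ : ∀ {π π′} → π ≤ᵖ π′ → ∀ i → block π i ⊆ block π′ i
  ≤ᵖ⇒⊆ {π} {π′} π≤π′ i x∈ with π≤π′ i
  ... | j , sub = subst (_ ∈_)
    (sym (proj₂ (partition-correct π′) j i (sub (proj₁ (partition-correct π) i)))) (sub x∈)

  ≤ᵖ-isDecPartialOrder : IsDecPartialOrder _≡_ _≤ᵖ_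
  ≤ᵖ-isDecPartialOrder = record
    { isPartialOrder = record
      { isPreorder = record
        { isEquivalence = isEquivalence
        ; reflexive     = λ { refl i → i , id }
        ; trans         = λ p q i → let j , s = p i ; k , t = q j in k , t ∘ s
        }
      ; antisym = λ {π} {π′} p q → value-injective (≡-ext λ i →
          Subset.⊆-antisym (≤ᵖ⇒⊆ {π} {π′} p i) (≤ᵖ⇒⊆ {π′} {π} q i))
      }
    ; _≟_  = _≟ᵖ_
    ; _≤?_ = _≤ᵖ?_
    }
    where
    ≡-ext : ∀ {m} {xs ys : Vec (Subset n) m} →
            (∀ i → Vec.lookup xs i ≡ Vec.lookup ys i) → xs ≡ ys
    ≡-ext {xs = xs} {ys} eq = trans (sym (Vec.tabulate∘lookup xs))
      (trans (Vec.tabulate-cong eq) (Vec.tabulate∘lookup ys))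

  classes : {_∼_ : Rel (Fin n) 0ℓ} → B.Decidable _∼_ → IsEquivalence _∼_ → Partition n
  classes _∼?_ isEq = tabulate (λ i → fromDec (i ∼?_)) ,ᵣ [ isPartition ]
    where
    open IsEquivalence isEq renaming (refl to ∼-refl; sym to ∼-sym; trans to ∼-trans)
    row : ∀ i → Vec.lookup (tabulate (λ i → fromDec (i ∼?_))) i ≡ fromDec (i ∼?_)
    row = Vec.lookup∘tabulate _
    isPartition : IsPartition (tabulate (λ i → fromDec (i ∼?_)))
    isPartition =
      (λ i → subst (i ∈_) (sym (row i)) (∈-fromDec⁺ (i ∼?_) ∼-refl)) ,
      (λ i j j∈ → let i∼j = ∈-fromDec⁻ (i ∼?_) (subst (j ∈_) (row i) j∈) in
        trans (row j) (trans
          (Vec.tabulate-cong λ k → does-⇔ (mk⇔ (∼-trans i∼j) (∼-trans (∼-sym i∼j))) (j ∼? k) (i ∼? k))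
          (sym (row i))))

  ∈-classes⁺ : ∀ {_∼_} (∼? : B.Decidable _∼_) (e : IsEquivalence _∼_) {i j} →
               i ∼ j → j ∈ block (classes ∼? e) i
  ∈-classes⁺ ∼? e {i} {j} i∼j =
    subst (j ∈_) (sym (Vec.lookup∘tabulate _ i)) (∈-fromDec⁺ (∼? i) i∼j)

  ∈-classes⁻ : ∀ {_∼_} (∼? : B.Decidable _∼_) (e : IsEquivalence _∼_) {i j} →
               j ∈ block (classes ∼? e) i → i ∼ j
  ∈-classes⁻ ∼? e {i} {j} j∈ =
    ∈-fromDec⁻ (∼? i) (subst (j ∈_) (Vec.lookup∘tabulate _ i) j∈)

partitions : ∀ n → Enumeration (Partition n)
partitions n = refinements isPartition? (vectors (subsets n) n)

record Graph (n : ℕ) : Set₁ where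
  field
    Adj    : Rel (Fin n) 0ℓ
    adj?   : B.Decidable Adj
    symm   : Symmetric Adj
    irrefl : Irreflexive _≡_ Adj

open Graph public

Connected : ∀ {n} → Graph n → Set
Connected G = ConnectedOn (Adj G) ⊤

walk-isEquivalence : ∀ {n} (G : Graph n) → IsEquivalence (Star (Adj G))
walk-isEquivalence G = record { refl = ε ; sym = Star.reverse (symm G) ; trans = _◅◅_ }

components : ∀ {n} → Graph n → Partition n
components G = classes (walk? (adj? G)) (walk-isEquivalence G)

-- The graphs on Fin n are counted as adjacency matrices, whose i-th row is the
-- set of neighbours of i.
IsAdjacency : ∀ {n} → Vec (Subset n) n → Set
IsAdjacency M = (∀ i j → j ∈ Vec.lookup M i → i ∈ Vec.lookup M j) ×
                (∀ i → i ∉ Vec.lookup M i)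

isAdjacency? : ∀ {n} → U.Decidable (IsAdjacency {n})
isAdjacency? M =
  (Fin.all? λ i → Fin.all? λ j →
    (j Subset.∈? Vec.lookup M i) →-dec (i Subset.∈? Vec.lookup M j)) ×-dec
  (Fin.all? λ i → ¬? (i Subset.∈? Vec.lookup M i))

AdjacencyMatrix : ℕ → Set
AdjacencyMatrix n = [ M ∈ Vec (Subset n) n ∣ IsAdjacency M ]

adjacencyMatrices : ∀ n → Enumeration (AdjacencyMatrix n)
adjacencyMatrices n = refinements isAdjacency? (vectors (subsets n) n)

graph : ∀ {n} → AdjacencyMatrix n → Graph n
graph (M ,ᵣ [ p ]) = record
  { Adj    = λ i j → j ∈ Vec.lookup M i
  ; adj?   = λ i j → j Subset.∈? Vec.lookup M i
  ; symm   = λ {i} {j} → proj₁ (recompute (isAdjacency? M) p) i j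
  ; irrefl = λ { {i} refl → proj₂ (recompute (isAdjacency? M) p) i }
  }

module _ {n : ℕ} (G : Graph n) where

  IsBond : Pred (Partition n) 0ℓ
  IsBond π = ∀ i → ConnectedOn (Adj G) (block π i)

  isBond? : U.Decidable IsBond
  isBond? π = Fin.all? λ i → connectedOn? (adj? G) (block π i)

  BondPartition : Set
  BondPartition = [ π ∈ Partition n ∣ IsBond π ]

  singletons : BondPartition
  singletons = classes Fin._≟_ isEquivalence ,ᵣ
    [ (λ i → (i , ∈-classes⁺ Fin._≟_ isEquivalence refl) , λ u v u∈ v∈ →
        subst (Star _ u) (trans (sym (∈-classes⁻ Fin._≟_ isEquivalence u∈))
                                (∈-classes⁻ Fin._≟_ isEquivalence v∈)) ε) ]

  Π : FinitePoset
  Π = record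
    { Carrier           = BondPartition
    ; _≤_               = _≤ᵖ_ on value
    ; isDecPartialOrder = record
      { isPartialOrder = record
        { isPreorder = record
          { isEquivalence = isEquivalence
          ; reflexive     = λ { {π} refl → P.reflexive {value π} refl }
          ; trans         = λ {π} {π′} {π″} → P.trans {value π} {value π′} {value π″}
          }
        ; antisym = λ {π} {π′} p q → value-injective (P.antisym {value π} {value π′} p q)
        }
      ; _≟_  = Refinement._≟_ _≟ᵖ_
      ; _≤?_ = λ π π′ → value π ≤ᵖ? value π′
      }
    ; enumeration = refinements isBond? (partitions n)
    ; 0̂           = singletons
    ; 0̂-minimum   = λ π i → i , λ {x} x∈ →
        subst (_∈ block (value π) i) (∈-classes⁻ Fin._≟_ isEquivalence x∈)
              (proj₁ (partition-correct (value π)) i)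
    }
    where module P = IsDecPartialOrder (≤ᵖ-isDecPartialOrder {n})

  component-connected : IsBond (components G)
  component-connected i = (i , ∈⁺ ε) , λ u v u∈ v∈ →
    let i→u = ∈⁻ u∈ in inside i→u (Star.reverse (symm G) i→u ◅◅ ∈⁻ v∈)
    where
    ∈⁺ : ∀ {j} → Star (Adj G) i j → j ∈ block (components G) i
    ∈⁺ = ∈-classes⁺ (walk? (adj? G)) (walk-isEquivalence G)
    ∈⁻ : ∀ {j} → j ∈ block (components G) i → Star (Adj G) i j
    ∈⁻ = ∈-classes⁻ (walk? (adj? G)) (walk-isEquivalence G)
    inside : ∀ {u v} → Star (Adj G) i u → Star (Adj G) u v →
             Star (Induced (Adj G) (block (components G) i)) u v
    inside i→u ε       = ε
    inside i→u (e ◅ w) = (∈⁺ i→u , ∈⁺ i→x , e) ◅ inside i→x w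
      where i→x = i→u ◅◅ e ◅ ε

  open FinitePoset Π using (_≤_)

  1̂ : BondPartition
  1̂ = components G ,ᵣ [ component-connected ]

  1̂-maximum : Maximum _≤_ 1̂
  1̂-maximum (π ,ᵣ [ p ]) i = i , λ {x} x∈ →
    ∈-classes⁺ (walk? (adj? G)) (walk-isEquivalence G)
      (Star.map (proj₂ ∘ proj₂)
        (proj₂ (recompute (isBond? π) p i) i x (proj₁ (partition-correct π) i) x∈))

-- A finite subset of ℤ_{>0}, listed without repetition.  Graphs with vertex
-- set V are graphs on Fin (size V), the vertex i standing for label V i.
record PositiveSet : Set where
  field
    size            : ℕ
    label           : Fin size → ℕ
    label-injective : ∀ {i j} → label i ≡ label j → i ≡ j
    label-positive  : ∀ i → 0 ℕ.< label i

open PositiveSet public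

Even Odd : Pred ℕ 0ℓ
Even m = 2 ∣ m
Odd m = ¬ Even m

even? : U.Decidable Even
even? = 2 ∣?_

odd? : U.Decidable Odd
odd? = ¬? ∘ even?

module _ (V : PositiveSet) where

  private
    n = size V
    lab = label V

  Γ : Graph n
  Γ = record
    { Adj    = λ u v → Arc u v ⊎ Arc v u
    ; adj?   = λ u v → arc? u v ⊎-dec arc? v u
    ; symm   = swap
    ; irrefl = λ { refl (inj₁ (u<u , _)) → ℕ.<-irrefl refl u<u
                 ; refl (inj₂ (u<u , _)) → ℕ.<-irrefl refl u<u }
    }
    where
    Arc : Rel (Fin n) 0ℓ
    Arc u v = lab u ℕ.< lab v × Odd (lab u) × Even (lab v)
    arc? : B.Decidable Arc
    arc? u v = lab u ℕ.<? lab v ×-dec odd? (lab u) ×-dec even? (lab v)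

  -- Both conditions are vacuous at leaves.
  IDConditions : Rel (Fin n) 0ℓ → (r : Fin n) → Pred (Fin n) 0ℓ
  IDConditions E r v =
    (Odd (lab v) → (∀ w → Descendant E r v w → lab v ℕ.< lab w) ×
                   (∀ w → Child E r v w → Even (lab w))) ×
    (Even (lab v) → (∀ w → Descendant E r v w → lab w ℕ.< lab v) ×
                    (∀ w → Child E r v w → Odd (lab w)))

  -- The tree meant here has node set S and as edges the E-edges within S.
  IsIDTree : Rel (Fin n) 0ℓ → Pred (Subset n) 0ℓ
  IsIDTree E S = IsTreeOn E S ×
    ∃ λ r → r ∈ S × (∀ w → w ∈ S → lab w ℕ.≤ lab r) ×
            (∀ v → v ∈ S → IDConditions (Induced E S) r v)

  IsIDForest : Pred (Graph n) _
  IsIDForest F = Acyclic (Adj F) × ∀ i → IsIDTree (Adj F) (block (components F) i)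

  isIDTree? : ∀ {E} → B.Decidable E → U.Decidable (IsIDTree E)
  isIDTree? {E} E? S = isTreeOn? E? S ×-dec
    Fin.any? λ r → r Subset.∈? S ×-dec
      (Fin.all? λ w → (w Subset.∈? S) →-dec (lab w ℕ.≤? lab r)) ×-dec
      (Fin.all? λ v → (v Subset.∈? S) →-dec idConditions? r v)
    where
    D? = descendant? (induced? E? S)
    C? = child? (induced? E? S)
    idConditions? : ∀ r → U.Decidable (IDConditions (Induced E S) r)
    idConditions? r v =
      (odd? (lab v) →-dec
        ((Fin.all? λ w → D? r v w →-dec (lab v ℕ.<? lab w)) ×-dec
         (Fin.all? λ w → C? r v w →-dec even? (lab w)))) ×-dec
      (even? (lab v) →-dec
        ((Fin.all? λ w → D? r v w →-dec (lab w ℕ.<? lab v)) ×-dec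
         (Fin.all? λ w → C? r v w →-dec odd? (lab w))))

  isIDForest? : U.Decidable IsIDForest
  isIDForest? F = acyclic? (adj? F) ×-dec
    Fin.all? λ i → isIDTree? (adj? F) (block (components F) i)

  #IDTrees : ℕ
  #IDTrees = # adjacencyMatrices n ∣ λ T → isIDTree? (adj? (graph T)) ⊤

  #IDForestsOnBlocks : Partition n → ℕ
  #IDForestsOnBlocks π = # adjacencyMatrices n ∣ λ F →
    isIDForest? (graph F) ×-dec components (graph F) ≟ᵖ π

  #IDForestsWithTrees : ℕ → ℕ
  #IDForestsWithTrees k = # adjacencyMatrices n ∣ λ F →
    isIDForest? (graph F) ×-dec ∣ components (graph F) ∣ ℕ.≟ k

{-# OPTIONS --safe #-}
-- The defining recursion of μ holds for (-1)^(n - |π|) #{ID forests on π} as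
-- soon as, for every bond partition π ≠ 0̂, the ID forests with all edges
-- inside blocks of π cancel in pairs.  An ID forest is a forest in Γ without a
-- path o – e – o′ – e′ such that o < o′ are odd and e < e′ are even; these are
-- forests without broken circuits, so they form a cone.  Its apex is the edge
-- ab between the least and the greatest vertex of a nontrivial block of π, and
-- toggling ab is the required sign-reversing involution.  The formula for χ
-- follows because rk π = n - |π|.
module Submission where

open import Defs
open import Data.Bool.Base using (if_then_else_; true; false)
open import Data.Empty using (⊥)
open import Data.Fin.Base as Fin using (Fin; zero; suc; toℕ)
import Data.Fin.Properties as Fin
open import Data.Fin.Subset using (Subset; _∈_; _∉_; ⊤)
import Data.Fin.Subset.Properties as Subset
open import Data.Integer using (ℤ; +_; -_; _+_; _*_; _^_; 0ℤ; 1ℤ; -1ℤ)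
import Data.Integer.Properties as ℤ
open import Data.Integer.Tactic.RingSolver using (solve-∀)
open import Data.Irrelevant using ([_])
open import Data.List as List using (List; []; _∷_; _++_; length; filter; foldr; map; allFin; upTo; applyUpTo)
import Data.List.Properties as List
open import Data.List.Membership.Propositional using (lose) renaming (_∈_ to _∈ₗ_; _∉_ to _∉ₗ_)
import Data.List.Membership.DecPropositional as DecMembership
import Data.List.Membership.Propositional.Properties as ∈ₗ
open import Data.List.Membership.Propositional.Properties.WithK using (unique∧set⇒bag)
open import Data.List.Relation.Binary.BagAndSetEquality using (∼bag⇒↭)
open import Data.List.Relation.Binary.Permutation.Propositional as ↭ using (_↭_)
open import Data.List.Relation.Binary.Permutation.Propositional.Properties using (↭-length)
open import Data.List.Relation.Unary.All as All using (All; []; _∷_)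
import Data.List.Relation.Unary.All.Properties as All
open import Data.List.Relation.Unary.AllPairs using ([]; _∷_)
open import Data.List.Relation.Unary.Any using (here; there)
open import Data.List.Relation.Unary.Unique.Propositional using (Unique)
import Data.List.Relation.Unary.Unique.DecPropositional.Properties as DecUnique
import Data.List.Relation.Unary.Unique.Propositional.Properties as Unique
open import Data.Nat as ℕ using (ℕ; zero; suc; z≤n; s≤s; _⊔_; _∸_)
import Data.Nat.Properties as ℕ
open import Data.List.Extrema ℕ.≤-totalOrder
  using (argmin; argmax; argmin-all; argmax-all; f[argmin]≤f[xs]; f[xs]≤f[argmax])
open import Data.Product using (Σ; ∃; _×_; _,_; proj₁; proj₂)
open import Data.Refinement using (value; value-injective) renaming (_,_ to _,ᵣ_)
open import Data.Sum.Base as Sum using (_⊎_; inj₁; inj₂; [_,_]′)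
open import Data.Vec.Base as Vec using (Vec; []; _∷_; tabulate)
import Data.Vec.Properties as Vec
open import Function.Base using (_∘_; id)
open import Function.Bundles using (mk⇔)
open import Induction.WellFounded as WF using ()
open import Level using (0ℓ)
open import Relation.Binary.Construct.Closure.ReflexiveTransitive as Star using (Star; ε; _◅_; _◅◅_)
open import Relation.Binary.Core using (Rel; _⇒_)
open import Relation.Binary.Definitions as B using (Symmetric; Irreflexive; tri<; tri≈; tri>)
open import Relation.Binary.PropositionalEquality
open import Relation.Binary.Structures using (IsDecPartialOrder; IsEquivalence)
open import Relation.Nullary using (¬_; Dec; yes; no; does; contradiction)
open import Relation.Nullary.Decidable
  using (_×-dec_; _→-dec_; _⊎-dec_; ¬?; dec-true; dec-false; decidable-stable; does-⇔; recompute)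
open import Relation.Unary as U using (Pred)

-- The definition of an ID tree refers to its greatest node, and adding `ab` may merge two trees and
-- move the root; hence the root-free condition `LocallyID`, which passes to subgraphs. It is
-- equivalent to the rooted one because, along a path leaving the root, each label falls strictly
-- between the two before it: labels zigzag in nested intervals, and a label escaping the current
-- interval produces a broken path. The same nesting, started at the least vertex `a` instead of the
-- root, shows that a tree containing both `a` and `b` already has the edge `ab`, so adding a
-- missing `ab` closes no cycle. A new broken path through `ab` would need a vertex below `a` or
-- above `b`. The factor `-1ℤ ^ size V` is the normalisation at `0̂`, which has `size V` blocks, one
-- ID forest and Möbius value 1. Connectedness of `Γ V` makes `1̂` a single block, as required by
-- trees on all of `V` and by the exponents `k ∸ 1`.

private variable
  A B : Set

-- Finite sums of integers

-- The Iverson bracket: counts and restricted sums become sums over a whole enumeration, whose order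
-- of summation can be exchanged.
⟦_⟧ : {P : Set} → Dec P → ℤ
⟦ p? ⟧ = if does p? then 1ℤ else 0ℤ

⟦⟧-yes : {P : Set} (p? : Dec P) → P → ⟦ p? ⟧ ≡ 1ℤ
⟦⟧-yes p? p = cong (if_then 1ℤ else 0ℤ) (dec-true p? p)

⟦⟧-no : {P : Set} (p? : Dec P) → ¬ P → ⟦ p? ⟧ ≡ 0ℤ
⟦⟧-no p? ¬p = cong (if_then 1ℤ else 0ℤ) (dec-false p? ¬p)

⟦⟧-cong : {P Q : Set} (p? : Dec P) (q? : Dec Q) → (P → Q) → (Q → P) → ⟦ p? ⟧ ≡ ⟦ q? ⟧
⟦⟧-cong p? q? f g = cong (if_then 1ℤ else 0ℤ) (does-⇔ (mk⇔ f g) p? q?)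

⟦⟧-× : {P Q : Set} (p? : Dec P) (q? : Dec Q) → ⟦ p? ×-dec q? ⟧ ≡ ⟦ p? ⟧ * ⟦ q? ⟧
⟦⟧-× (yes _) q? = sym (ℤ.*-identityˡ ⟦ q? ⟧)
⟦⟧-× (no _)  q? = refl

⟦⟧*-cong : {P : Set} (p? : Dec P) {x y : ℤ} → (P → x ≡ y) → ⟦ p? ⟧ * x ≡ ⟦ p? ⟧ * y
⟦⟧*-cong (yes p) eq = cong (λ s → 1ℤ * s) (eq p)
⟦⟧*-cong (no _)  _  = refl

-- One cancelling pair: `P` and `k` belong to a graph, `Q` and `l` to the same graph with one more
-- edge. That the edge costs exactly one component is known only when the larger graph is a forest,
-- hence the premise `Q`.
⟦⟧*-1^-negate : {P Q : Set} (p? : Dec P) (q? : Dec Q) → (P → Q) → (Q → P) → ∀ {k l} → (Q → k ≡ suc l) →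
                ⟦ q? ⟧ * -1ℤ ^ l ≡ - (⟦ p? ⟧ * -1ℤ ^ k)
⟦⟧*-1^-negate p? q? f g {k} {l} k≡1+l = begin
  ⟦ q? ⟧ * -1ℤ ^ l             ≡⟨ negate ⟦ q? ⟧ (-1ℤ ^ l) ⟩
  - (⟦ q? ⟧ * -1ℤ ^ suc l)     ≡⟨ cong -_ (⟦⟧*-cong q? λ q → cong (λ k → -1ℤ ^ k) (sym (k≡1+l q))) ⟩
  - (⟦ q? ⟧ * -1ℤ ^ k)         ≡⟨ cong (λ c → - (c * -1ℤ ^ k)) (⟦⟧-cong q? p? g f) ⟩
  - (⟦ p? ⟧ * -1ℤ ^ k)         ∎
  where
  open ≡-Reasoning
  negate : ∀ p s → p * s ≡ - (p * (-1ℤ * s))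
  negate = solve-∀

·t^-coefficient : ∀ c e m → (c ·t^ e) m ≡ ⟦ e ℕ.≟ m ⟧ * c
·t^-coefficient c e m with does (e ℕ.≟ m)
... | true  = sym (ℤ.*-identityˡ c)
... | false = refl

+-congˡ : (x : ℤ) {y z : ℤ} → y ≡ z → x + y ≡ x + z
+-congˡ x eq = cong (λ s → x + s) eq

∑-cong : {f g : A → ℤ} (xs : List A) → (∀ x → f x ≡ g x) → ∑ℤ xs f ≡ ∑ℤ xs g
∑-cong []       eq = refl
∑-cong (x ∷ xs) eq = cong₂ _+_ (eq x) (∑-cong xs eq)

∑-0 : (xs : List A) → ∑ℤ xs (λ _ → 0ℤ) ≡ 0ℤ
∑-0 []       = refl
∑-0 (x ∷ xs) = trans (ℤ.+-identityˡ _) (∑-0 xs)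

∑-+ : (xs : List A) (f g : A → ℤ) → ∑ℤ xs (λ x → f x + g x) ≡ ∑ℤ xs f + ∑ℤ xs g
∑-+ []       f g = refl
∑-+ (x ∷ xs) f g = trans (+-congˡ (f x + g x) (∑-+ xs f g)) (interchange (f x) (g x) _ _)
  where
  interchange : ∀ a b c d → (a + b) + (c + d) ≡ (a + c) + (b + d)
  interchange = solve-∀

∑-*ˡ : (c : ℤ) (xs : List A) (f : A → ℤ) → ∑ℤ xs (λ x → c * f x) ≡ c * ∑ℤ xs f
∑-*ˡ c []       f = sym (ℤ.*-zeroʳ c)
∑-*ˡ c (x ∷ xs) f = trans (+-congˡ (c * f x) (∑-*ˡ c xs f)) (sym (ℤ.*-distribˡ-+ c (f x) _))

∑-neg : (xs : List A) (f : A → ℤ) → ∑ℤ xs (λ x → - f x) ≡ - ∑ℤ xs f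
∑-neg []       f = refl
∑-neg (x ∷ xs) f = trans (+-congˡ (- f x) (∑-neg xs f)) (sym (ℤ.neg-distrib-+ (f x) _))

∑-swap : (xs : List A) (ys : List B) (f : A → B → ℤ) →
         ∑ℤ xs (λ x → ∑ℤ ys (f x)) ≡ ∑ℤ ys (λ y → ∑ℤ xs (λ x → f x y))
∑-swap []       ys f = sym (∑-0 ys)
∑-swap (x ∷ xs) ys f = trans (+-congˡ (∑ℤ ys (f x)) (∑-swap xs ys f)) (sym (∑-+ ys (f x) _))

∑-map : (h : A → B) (xs : List A) (f : B → ℤ) → ∑ℤ (List.map h xs) f ≡ ∑ℤ xs (f ∘ h)
∑-map h []       f = refl
∑-map h (x ∷ xs) f = +-congˡ (f (h x)) (∑-map h xs f)

∑-vanishing : {f : A → ℤ} (xs : List A) → All (λ x → f x ≡ 0ℤ) xs → ∑ℤ xs f ≡ 0ℤ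
∑-vanishing []       []         = refl
∑-vanishing (x ∷ xs) (eq ∷ eqs) = trans (cong₂ _+_ eq (∑-vanishing xs eqs)) refl

∑-single : {f : A → ℤ} {xs : List A} {y : A} → Unique xs → y ∈ₗ xs →
           (∀ x → x ≢ y → f x ≡ 0ℤ) → ∑ℤ xs f ≡ f y
∑-single {f = f} {x ∷ xs} (y∉ ∷ _) (here refl) eq =
  trans (+-congˡ (f x) (∑-vanishing xs (All.map (λ y≢x → eq _ (y≢x ∘ sym)) y∉))) (ℤ.+-identityʳ _)
∑-single {xs = x ∷ xs} (x∉ ∷ !) (there y∈) eq =
  trans (cong₂ _+_ (eq _ (All.lookup x∉ y∈)) (∑-single ! y∈ eq)) (ℤ.+-identityˡ _)

∑-↭ : {xs ys : List A} (f : A → ℤ) → xs ↭ ys → ∑ℤ xs f ≡ ∑ℤ ys f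
∑-↭ f ↭.refl         = refl
∑-↭ f (↭.prep x p)   = +-congˡ (f x) (∑-↭ f p)
∑-↭ f (↭.swap x y p) = trans (cong (λ s → f x + (f y + s)) (∑-↭ f p)) (exchange (f x) (f y) _)
  where
  exchange : ∀ a b c → a + (b + c) ≡ b + (a + c)
  exchange = solve-∀
∑-↭ f (↭.trans p q)  = trans (∑-↭ f p) (∑-↭ f q)

unique∧⊆⊇⇒↭ : {xs ys : List A} → Unique xs → Unique ys →
              (∀ {x} → x ∈ₗ xs → x ∈ₗ ys) → (∀ {x} → x ∈ₗ ys → x ∈ₗ xs) → xs ↭ ys
unique∧⊆⊇⇒↭ xs! ys! f g = ∼bag⇒↭ (unique∧set⇒bag xs! ys! (mk⇔ f g))

x≡-x⇒x≡0 : ∀ x → x ≡ - x → x ≡ 0ℤ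
x≡-x⇒x≡0 (+ zero) _ = refl

-- `ι` permutes the enumeration, so the sum equals its own negative. Fixed points need no separate
-- treatment, since `f` vanishes there.
∑-signReversing : (e : Enumeration A) (f : A → ℤ) (ι : A → A) → (∀ x → ι (ι x) ≡ x) →
                  (∀ x → f (ι x) ≡ - f x) → ∑ℤ (elements e) f ≡ 0ℤ
∑-signReversing e f ι ιι f-ι = x≡-x⇒x≡0 _ (begin
  ∑ℤ xs f               ≡⟨ ∑-↭ f (unique∧⊆⊇⇒↭ (unique e)
                              (Unique.map⁺ ι-injective (unique e))
                              (λ {x} _ → subst (_∈ₗ List.map ι xs) (ιι x) (∈ₗ.∈-map⁺ ι (complete e (ι x))))
                              (λ {x} _ → complete e x)) ⟩
  ∑ℤ (List.map ι xs) f  ≡⟨ ∑-map ι xs f ⟩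
  ∑ℤ xs (f ∘ ι)         ≡⟨ ∑-cong xs f-ι ⟩
  ∑ℤ xs (λ x → - f x)   ≡⟨ ∑-neg xs f ⟩
  - ∑ℤ xs f             ∎)
  where
  open ≡-Reasoning
  xs = elements e
  ι-injective : ∀ {x y} → ι x ≡ ι y → x ≡ y
  ι-injective {x} {y} eq = trans (sym (ιι x)) (trans (cong ι eq) (ιι y))

#-as-∑ : (e : Enumeration A) {P : Pred A 0ℓ} (P? : U.Decidable P) →
         + # e ∣ P? ≡ ∑ℤ (elements e) (λ x → ⟦ P? x ⟧)
#-as-∑ {A = A} e {P} P? = go (elements e)
  where
  go : (xs : List A) → + length (filter P? xs) ≡ ∑ℤ xs (λ x → ⟦ P? x ⟧)
  go [] = refl
  go (x ∷ xs) with does (P? x)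
  ... | true  = cong (λ s → 1ℤ + s) (go xs)
  ... | false = trans (go xs) (sym (ℤ.+-identityˡ _))

-- Double counting: each `M` with `P M` contributes at exactly one `σ`, which exists by `lift` and
-- is unique by injectivity of `v`. It serves twice, with `h M` the partition into components and
-- with `h M` the number of components.
∑-fibres : {C : Set} (es : Enumeration B) (eM : Enumeration A) {P : Pred A 0ℓ} (P? : U.Decidable P)
  (_≟_ : (x y : C) → Dec (x ≡ y)) (h : A → C) (v : B → C) → (∀ {σ τ} → v σ ≡ v τ → σ ≡ τ) →
  (∀ M → P M → ∃ λ σ → v σ ≡ h M) → (g : C → ℤ) →
  ∑ℤ (elements es) (λ σ → g (v σ) * + # eM ∣ (λ M → P? M ×-dec h M ≟ v σ)) ≡
  ∑ℤ (elements eM) (λ M → ⟦ P? M ⟧ * g (h M))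
∑-fibres es eM {P} P? _≟_ h v v-injective lift g = begin
  ∑ℤ σs (λ σ → g (v σ) * + # eM ∣ (λ M → on? M (v σ)))
    ≡⟨ ∑-cong σs (λ σ → trans (cong (λ c → g (v σ) * c) (#-as-∑ eM (λ M → on? M (v σ))))
         (sym (∑-*ˡ (g (v σ)) Ms (λ M → ⟦ on? M (v σ) ⟧)))) ⟩
  ∑ℤ σs (λ σ → ∑ℤ Ms (λ M → g (v σ) * ⟦ on? M (v σ) ⟧))
    ≡⟨ ∑-swap σs Ms (λ σ M → g (v σ) * ⟦ on? M (v σ) ⟧) ⟩
  ∑ℤ Ms (λ M → ∑ℤ σs (λ σ → g (v σ) * ⟦ on? M (v σ) ⟧))
    ≡⟨ ∑-cong Ms (λ M → contribution M (P? M)) ⟩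
  ∑ℤ Ms (λ M → ⟦ P? M ⟧ * g (h M))
    ∎
  where
  open ≡-Reasoning
  σs = elements es
  Ms = elements eM
  on? : ∀ M σ → Dec (P M × h M ≡ σ)
  on? M σ = P? M ×-dec (h M ≟ σ)

  vanish : ∀ c {P : Set} (p? : Dec P) → ¬ P → c * ⟦ p? ⟧ ≡ 0ℤ
  vanish c p? ¬p = trans (cong (λ d → c * d) (⟦⟧-no p? ¬p)) (ℤ.*-zeroʳ c)

  contribution : ∀ M → (p? : Dec (P M)) → ∑ℤ σs (λ σ → g (v σ) * ⟦ on? M (v σ) ⟧) ≡ ⟦ p? ⟧ * g (h M)
  contribution M (no ¬p) = trans
    (∑-cong σs (λ σ → vanish (g (v σ)) (on? M (v σ)) (¬p ∘ proj₁))) (∑-0 σs)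
  contribution M (yes p) = let σ₀ , σ₀≡ = lift M p in begin
    ∑ℤ σs (λ σ → g (v σ) * ⟦ on? M (v σ) ⟧)
      ≡⟨ ∑-single (unique es) (complete es σ₀) (λ σ σ≢ → vanish (g (v σ)) (on? M (v σ))
           λ (_ , eq) → σ≢ (v-injective (trans (sym eq) (sym σ₀≡)))) ⟩
    g (v σ₀) * ⟦ on? M (v σ₀) ⟧
      ≡⟨ cong₂ (λ τ c → g τ * c) σ₀≡ (⟦⟧-yes (on? M (v σ₀)) (p , sym σ₀≡)) ⟩
    g (h M) * 1ℤ
      ≡⟨ ℤ.*-comm (g (h M)) 1ℤ ⟩
    1ℤ * g (h M) ∎

#≡1 : (e : Enumeration A) {P : Pred A 0ℓ} (P? : U.Decidable P) (y : A) → P y → (∀ x → P x → x ≡ y) →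
      + # e ∣ P? ≡ 1ℤ
#≡1 e P? y py unique-y = trans (#-as-∑ e P?) (trans
  (∑-single (unique e) (complete e y) (λ x x≢y → ⟦⟧-no (P? x) (x≢y ∘ unique-y x)))
  (⟦⟧-yes (P? y) py))

#-cong : (e : Enumeration A) {P Q : Pred A 0ℓ} (P? : U.Decidable P) (Q? : U.Decidable Q) →
         (∀ x → P x → Q x) → (∀ x → Q x → P x) → # e ∣ P? ≡ # e ∣ Q?
#-cong e P? Q? f g = ℤ.+-injective (trans (#-as-∑ e P?)
  (trans (∑-cong (elements e) (λ x → ⟦⟧-cong (P? x) (Q? x) (f x) (g x))) (sym (#-as-∑ e Q?))))

-1^n*-1^n : ∀ n → -1ℤ ^ n * -1ℤ ^ n ≡ 1ℤ
-1^n*-1^n zero    = refl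
-1^n*-1^n (suc n) = trans (square (-1ℤ ^ n)) (-1^n*-1^n n)
  where
  square : ∀ x → (-1ℤ * x) * (-1ℤ * x) ≡ x * x
  square = solve-∀

-- Möbius function and rank by their recursions

maximum-≤ : {f : A → ℕ} {k : ℕ} (xs : List A) → (∀ x → f x ℕ.≤ k) → foldr (λ x h → f x ⊔ h) 0 xs ℕ.≤ k
maximum-≤ []       f≤k = z≤n
maximum-≤ (x ∷ xs) f≤k = ℕ.⊔-lub (f≤k x) (maximum-≤ xs f≤k)

maximum-≥ : (f : A → ℕ) {xs : List A} {x : A} → x ∈ₗ xs → f x ℕ.≤ foldr (λ x h → f x ⊔ h) 0 xs
maximum-≥ f (here refl) = ℕ.m≤m⊔n _ _
maximum-≥ f (there x∈)  = ℕ.≤-trans (maximum-≥ f x∈) (ℕ.m≤n⊔m _ _)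

maximum-cong : {f g : A → ℕ} (xs : List A) → (∀ x → f x ≡ g x) →
               foldr (λ x h → f x ⊔ h) 0 xs ≡ foldr (λ x h → g x ⊔ h) 0 xs
maximum-cong []       eq = refl
maximum-cong (x ∷ xs) eq = cong₂ _⊔_ (eq x) (maximum-cong xs eq)

module _ (P : FinitePoset) where

  open FinitePoset P
  open IsDecPartialOrder isDecPartialOrder using () renaming (reflexive to ≤-reflexive)

  private
    xs = elements enumeration

  μ-term-cong : ∀ x y {f g : ∀ {z} → z < y → ℤ} → (∀ {z} (z<y : z < y) → f z<y ≡ g z<y) →
                ∀ z → μ-term x y f z ≡ μ-term x y g z
  μ-term-cong x y eq z with x ≤? z | z <? y
  ... | yes _ | yes z<y = eq z<y
  ... | yes _ | no _    = refl
  ... | no _  | _       = refl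

  μ-step-cong : ∀ x y {f g : ∀ {z} → z < y → ℤ} → (∀ {z} (z<y : z < y) → f z<y ≡ g z<y) →
                μ-step x y f ≡ μ-step x y g
  μ-step-cong x y eq = cong (λ s → if does (x ≟ y) then 1ℤ else - s) (∑-cong xs (μ-term-cong x y eq))

  μ-unfold : ∀ x y → μ x y ≡ μ-step x y (λ {z} _ → μ x z)
  μ-unfold x y = WF.FixPoint.unfold-wfRec <-wellFounded (λ _ → ℤ) (μ-step x) (λ y → μ-step-cong x y)

  ⟦≤⟧ : ∀ z y → ⟦ z ≤? y ⟧ ≡ ⟦ z <? y ⟧ + ⟦ z ≟ y ⟧
  ⟦≤⟧ z y = case (z ≟ y)
    where
    case : (z≟y : Dec (z ≡ y)) → ⟦ z ≤? y ⟧ ≡ ⟦ z <? y ⟧ + ⟦ z≟y ⟧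
    case (yes z≡y) = trans (⟦⟧-yes (z ≤? y) (≤-reflexive z≡y))
      (cong (λ c → c + 1ℤ) (sym (⟦⟧-no (z <? y) λ z<y → proj₂ z<y z≡y)))
    case (no z≢y) = trans (⟦⟧-cong (z ≤? y) (z <? y) (λ z≤y → z≤y , z≢y) proj₁) (sym (ℤ.+-identityʳ _))

  -- Separating the term `z = y` from the vanishing sum turns it into the defining recursion of `μ`;
  -- well-founded induction then identifies the two functions.
  μ-unique : (s : Carrier → ℤ) → s 0̂ ≡ 1ℤ → (∀ y → y ≢ 0̂ → ∑ℤ xs (λ z → ⟦ z ≤? y ⟧ * s z) ≡ 0ℤ) →
             ∀ y → μ 0̂ y ≡ s y
  μ-unique s s-0̂ s-∑ = WF.All.wfRec <-wellFounded 0ℓ (λ y → μ 0̂ y ≡ s y) λ y ih → trans (μ-unfold 0̂ y) (step y ih)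
    where
    term : ∀ y → (∀ {z} → z < y → μ 0̂ z ≡ s z) → ∀ z → μ-term 0̂ y (λ {z} _ → μ 0̂ z) z ≡ ⟦ z <? y ⟧ * s z
    term y ih z with 0̂ ≤? z | z <? y
    ... | yes _   | yes z<y = trans (ih z<y) (sym (trans (cong (λ c → c * s z) (⟦⟧-yes (z <? y) z<y)) (ℤ.*-identityˡ (s z))))
    ... | yes _   | no z≮y  = sym (cong (λ c → c * s z) (⟦⟧-no (z <? y) z≮y))
    ... | no 0̂≰z  | _       = contradiction (0̂-minimum z) 0̂≰z

    split : ∀ y → ∑ℤ xs (λ z → ⟦ z ≤? y ⟧ * s z) ≡ ∑ℤ xs (λ z → ⟦ z <? y ⟧ * s z) + s y
    split y = trans
      (trans (∑-cong xs (λ z → trans (cong (λ c → c * s z) (⟦≤⟧ z y)) (ℤ.*-distribʳ-+ (s z) ⟦ z <? y ⟧ ⟦ z ≟ y ⟧)))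
        (∑-+ xs (λ z → ⟦ z <? y ⟧ * s z) (λ z → ⟦ z ≟ y ⟧ * s z)))
      (cong (λ c → ∑ℤ xs (λ z → ⟦ z <? y ⟧ * s z) + c)
        (trans (∑-single (unique enumeration) (complete enumeration y)
                 (λ z z≢y → cong (λ c → c * s z) (⟦⟧-no (z ≟ y) z≢y)))
          (trans (cong (λ c → c * s y) (⟦⟧-yes (y ≟ y) refl)) (ℤ.*-identityˡ (s y)))))

    a+b≡0⇒-a≡b : ∀ a b → a + b ≡ 0ℤ → - a ≡ b
    a+b≡0⇒-a≡b a b eq = trans (sym (ℤ.+-identityʳ (- a))) (trans (cong (λ c → - a + c) (sym eq)) (cancel a b))
      where
      cancel : ∀ a b → - a + (a + b) ≡ b
      cancel = solve-∀

    step : ∀ y → (∀ {z} → z < y → μ 0̂ z ≡ s z) → μ-step 0̂ y (λ {z} _ → μ 0̂ z) ≡ s y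
    step y ih with 0̂ ≟ y
    ... | yes refl = sym s-0̂
    ... | no  0̂≢y  = trans (cong -_ (∑-cong xs (term y ih)))
      (a+b≡0⇒-a≡b _ (s y) (trans (sym (split y)) (s-∑ y (0̂≢y ∘ sym))))

  rk-term-cong : ∀ y {f g : ∀ {z} → z < y → ℕ} → (∀ {z} (z<y : z < y) → f z<y ≡ g z<y) →
                 ∀ z → rk-term y f z ≡ rk-term y g z
  rk-term-cong y eq z with z <? y
  ... | yes z<y = cong suc (eq z<y)
  ... | no _    = refl

  rk-unfold : ∀ y → rk y ≡ rk-step y (λ {z} _ → rk z)
  rk-unfold y = WF.FixPoint.unfold-wfRec <-wellFounded (λ _ → ℕ) rk-step
    (λ y eq → maximum-cong xs (rk-term-cong y eq))

  -- Strict monotonicity bounds the length of every chain below `y` by `r y`; the second premise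
  -- supplies a chain that attains the bound.
  rk-unique : (r : Carrier → ℕ) → (∀ {z y} → z < y → r z ℕ.< r y) →
              (∀ y → r y ≡ 0 ⊎ ∃ λ z → z < y × r y ≡ suc (r z)) → ∀ y → rk y ≡ r y
  rk-unique r r-mono r-cover = WF.All.wfRec <-wellFounded 0ℓ (λ y → rk y ≡ r y) λ y ih →
    trans (rk-unfold y) (ℕ.≤-antisym (maximum-≤ xs (upper y ih)) (lower y ih (r-cover y)))
    where
    upper : ∀ y → (∀ {z} → z < y → rk z ≡ r z) → ∀ z → rk-term y (λ {z} _ → rk z) z ℕ.≤ r y
    upper y ih z with z <? y
    ... | yes z<y = subst (ℕ._< r y) (sym (ih z<y)) (r-mono z<y)
    ... | no _    = z≤n

    term-≥ : ∀ {z y} → z < y → suc (rk z) ℕ.≤ rk-term y (λ {z} _ → rk z) z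
    term-≥ {z} {y} z<y with z <? y
    ... | yes _   = ℕ.≤-refl
    ... | no  z≮y = contradiction z<y z≮y

    lower : ∀ y → (∀ {z} → z < y → rk z ≡ r z) → r y ≡ 0 ⊎ (∃ λ z → z < y × r y ≡ suc (r z)) →
            r y ℕ.≤ rk-step y (λ {z} _ → rk z)
    lower y ih (inj₁ eq) = subst (ℕ._≤ _) (sym eq) z≤n
    lower y ih (inj₂ (z , z<y , eq)) = subst (ℕ._≤ _) (trans (cong suc (ih z<y)) (sym eq))
      (ℕ.≤-trans (term-≥ z<y) (maximum-≥ (rk-term y (λ {z} _ → rk z)) (complete enumeration z)))

-- Walks, cycles and bridges

module _ {n : ℕ} {P : Pred (Fin n) 0ℓ} (P? : U.Decidable P) (f : Fin n → ℕ) where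

  private
    candidates : List (Fin n)
    candidates = filter P? (allFin n)

    candidate : ∀ {i} → P i → i ∈ₗ candidates
    candidate {i} = ∈ₗ.∈-filter⁺ P? (∈ₗ.∈-allFin i)

    candidates-P : All P candidates
    candidates-P = All.all-filter P? (allFin n)

  ∃-min : ∃ P → ∃ λ m → P m × (∀ i → P i → f m ℕ.≤ f i)
  ∃-min (p , pp) = argmin f p candidates , argmin-all f pp candidates-P ,
    λ i pi → All.lookup (f[argmin]≤f[xs] {f = f} p candidates) (candidate pi)

  ∃-max : ∃ P → ∃ λ m → P m × (∀ i → P i → f i ℕ.≤ f m)
  ∃-max (p , pp) = argmax f p candidates , argmax-all f pp candidates-P ,
    λ i pi → All.lookup (f[xs]≤f[argmax] {f = f} p candidates) (candidate pi)

module _ {n : ℕ} where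

  private variable
    E E′ : Rel (Fin n) 0ℓ
    u v x y : Fin n

  visits-map : (f : E ⇒ E′) (w : Star E u v) → visits (Star.map f w) ≡ visits w
  visits-map f ε       = refl
  visits-map f (e ◅ w) = cong (_ ∷_) (visits-map f w)

  start∈visits : (w : Star E u v) → u ∈ₗ visits w
  start∈visits ε       = here refl
  start∈visits (_ ◅ _) = here refl

  end∈visits : (w : Star E u v) → v ∈ₗ visits w
  end∈visits ε       = here refl
  end∈visits (_ ◅ w) = there (end∈visits w)

  visits-∷ʳ : (w : Star E u v) (e : E v x) → visits (w ◅◅ e ◅ ε) ≡ visits w ++ (x ∷ [])
  visits-∷ʳ ε       e = refl
  visits-∷ʳ (_ ◅ w) e = cong (_ ∷_) (visits-∷ʳ w e)

  path-∷ʳ : (p : Path E u v) → E v x → x ∉ₗ visits (proj₁ p) →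
            Σ (Path E u x) λ q → ∀ {y} → y ∈ₗ visits (proj₁ p) → y ∈ₗ visits (proj₁ q)
  path-∷ʳ {x = x} (w , !) e x∉ =
    (w ◅◅ e ◅ ε , subst Unique (sym (visits-∷ʳ w e))
                    (Unique.++⁺ ! ([] ∷ []) λ { (x∈ , here refl) → x∉ x∈ })) ,
    λ y∈ → subst (_ ∈ₗ_) (sym (visits-∷ʳ w e)) (∈ₗ.∈-++⁺ˡ y∈)

  distinct⇒2≤length : {xs : List (Fin n)} → u ∈ₗ xs → v ∈ₗ xs → u ≢ v → 2 ℕ.≤ length xs
  distinct⇒2≤length (here refl) (here refl) u≢v = contradiction refl u≢v
  distinct⇒2≤length {xs = _ ∷ _ ∷ _} _ _ _ = s≤s (s≤s z≤n)
  distinct⇒2≤length {xs = _ ∷ []} (there ()) _ _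
  distinct⇒2≤length {xs = _ ∷ []} (here _) (there ()) _

  -- The part of the path from the earlier of `a`, `b` to `v` still contains the other one; were
  -- they distinct, it would have at least three vertices and be closed to a cycle by the edge at
  -- `v`.
  parent-unique : Acyclic E → (w : Star E x v) → Unique (visits w) →
                  ∀ {a b} → a ∈ₗ visits w → b ∈ₗ visits w → E v a → E v b → a ≢ v → b ≢ v → a ≡ b
  parent-unique acyclic ε _ (here refl) _ _ _ a≢v _ = contradiction refl a≢v
  parent-unique acyclic (_ ◅ _) _ (here refl) (here refl) _ _ _ _ = refl
  parent-unique acyclic (e ◅ w) ! (here refl) (there b∈) va _ _ b≢v =
    contradiction (_ , _ , va , (e ◅ w , !) , s≤s (distinct⇒2≤length b∈ (end∈visits w) b≢v)) acyclic
  parent-unique acyclic (e ◅ w) ! (there a∈) (here refl) _ vb a≢v _ =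
    contradiction (_ , _ , vb , (e ◅ w , !) , s≤s (distinct⇒2≤length a∈ (end∈visits w) a≢v)) acyclic
  parent-unique acyclic (_ ◅ w) (_ ∷ !) (there a∈) (there b∈) va vb a≢v b≢v =
    parent-unique acyclic w ! a∈ b∈ va vb a≢v b≢v

  SameEdge : (a b u v : Fin n) → Set
  SameEdge a b u v = (u ≡ a × v ≡ b) ⊎ (u ≡ b × v ≡ a)

  _∖⟨_,_⟩ _∪⟨_,_⟩ : Rel (Fin n) 0ℓ → Fin n → Fin n → Rel (Fin n) 0ℓ
  (E ∖⟨ a , b ⟩) u v = E u v × ¬ SameEdge a b u v
  (E ∪⟨ a , b ⟩) u v = E u v ⊎ SameEdge a b u v

  ∖-symmetric : ∀ {a b} → Symmetric E → Symmetric (E ∖⟨ a , b ⟩)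
  ∖-symmetric E-sym (e , ≢) = E-sym e ,
    λ { (inj₁ (refl , refl)) → ≢ (inj₂ (refl , refl)) ; (inj₂ (refl , refl)) → ≢ (inj₁ (refl , refl)) }

  -- Acyclicity stated with arbitrary walks instead of repetition-free paths, so that it can be
  -- transported along inclusions of edge sets by mapping walks.
  AllBridges : Rel (Fin n) 0ℓ → Set
  AllBridges E = ∀ {u v} → E u v → ¬ Star (E ∖⟨ u , v ⟩) u v

  acyclic⇒bridges : Symmetric E → Irreflexive _≡_ E → Acyclic E → AllBridges E
  acyclic⇒bridges {E} E-sym E-irrefl acyclic {u} {v} e w with walk⇒path w
  ... | ε , _ = E-irrefl refl e
  ... | (_ , ≢) ◅ ε , _ = ≢ (inj₁ (refl , refl))
  ... | p@(_ ◅ _ ◅ q) , ! = acyclic (u , v , E-sym e ,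
    (Star.map proj₁ p , subst Unique (sym (visits-map proj₁ p)) !) ,
    subst (3 ℕ.≤_) (sym (cong length (visits-map proj₁ p))) (s≤s (s≤s (visits-nonempty q))))
    where
    visits-nonempty : ∀ {F : Rel (Fin n) 0ℓ} {s t} (w : Star F s t) → 1 ℕ.≤ length (visits w)
    visits-nonempty ε       = s≤s z≤n
    visits-nonempty (_ ◅ _) = s≤s z≤n

  avoiding-start : (w : Star E x y) → u ∉ₗ visits w → Star (E ∖⟨ u , v ⟩) x y
  avoiding-start ε u∉ = ε
  avoiding-start (e ◅ w) u∉ =
    (e , λ { (inj₁ (refl , _)) → u∉ (here refl) ; (inj₂ (_ , refl)) → u∉ (there (start∈visits w)) })
    ◅ avoiding-start w (u∉ ∘ there)

  bridges⇒acyclic : Symmetric E → AllBridges E → Acyclic E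
  bridges⇒acyclic E-sym bridges (u , v , e , (ε , _) , s≤s ())
  bridges⇒acyclic E-sym bridges (u , v , e , (_ ◅ ε , _) , s≤s (s≤s ()))
  bridges⇒acyclic E-sym bridges (u , v , e , (f ◅ g ◅ w , u∉ ∷ x∉ ∷ _) , _) = bridges (E-sym e)
    ((f , λ { (inj₁ (_ , refl)) → All.lookup x∉ (end∈visits w) refl
            ; (inj₂ (_ , refl)) → All.lookup u∉ (here refl) refl })
     ◅ avoiding-start (g ◅ w) (λ u∈ → All.lookup u∉ u∈ refl))

  -- In E ∪ ab, a walk either stays in E or can be shortened to cross ab once.
  ∪-walk⁻ : ∀ {a b} → Symmetric E → Star (E ∪⟨ a , b ⟩) x y →
            Star E x y ⊎ (Star E x a × Star E b y) ⊎ (Star E x b × Star E a y)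
  ∪-walk⁻ E-sym ε = inj₁ ε
  ∪-walk⁻ E-sym (inj₁ e ◅ w) with ∪-walk⁻ E-sym w
  ... | inj₁ p              = inj₁ (e ◅ p)
  ... | inj₂ (inj₁ (p , q)) = inj₂ (inj₁ (e ◅ p , q))
  ... | inj₂ (inj₂ (p , q)) = inj₂ (inj₂ (e ◅ p , q))
  ∪-walk⁻ E-sym (inj₂ (inj₁ (refl , refl)) ◅ w) with ∪-walk⁻ E-sym w
  ... | inj₁ p              = inj₂ (inj₁ (ε , p))
  ... | inj₂ (inj₁ (p , q)) = inj₂ (inj₁ (ε , q))
  ... | inj₂ (inj₂ (p , q)) = inj₁ q
  ∪-walk⁻ E-sym (inj₂ (inj₂ (refl , refl)) ◅ w) with ∪-walk⁻ E-sym w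
  ... | inj₁ p              = inj₂ (inj₂ (ε , p))
  ... | inj₂ (inj₁ (p , q)) = inj₁ q
  ... | inj₂ (inj₂ (p , q)) = inj₂ (inj₂ (ε , q))

  -- An old edge `uv` stays a bridge: a detour around it that crosses `ab`, closed up by `uv`
  -- itself, would contain a walk from `a` to `b` in `E`.
  bridges-∪ : ∀ {a b} → Symmetric E → AllBridges E → ¬ Star E a b → AllBridges (E ∪⟨ a , b ⟩)
  bridges-∪ {E} {a} {b} E-sym bridges a≁b = bridge
    where
    bridge : AllBridges (E ∪⟨ a , b ⟩)
    bridge (inj₂ (inj₁ (refl , refl))) w =
      a≁b (Star.map (λ { (inj₁ e , _) → e ; (inj₂ s , ≢) → contradiction s ≢ }) w)
    bridge (inj₂ (inj₂ (refl , refl))) w =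
      a≁b (Star.reverse E-sym (Star.map
        (λ { (inj₁ e , _) → e ; (inj₂ s , ≢) → contradiction ([ inj₂ , inj₁ ]′ s) ≢ }) w))
    bridge {u} {v} (inj₁ e) w with ∪-walk⁻ {a = a} {b} (∖-symmetric E-sym)
        (Star.map (λ { (inj₁ f , ≢) → inj₁ (f , ≢) ; (inj₂ s , _) → inj₂ s }) w)
    ... | inj₁ p = bridges e p
    ... | inj₂ (inj₁ (p , q)) = a≁b (Star.reverse E-sym (Star.map proj₁ p) ◅◅
                                      e ◅ Star.reverse E-sym (Star.map proj₁ q))
    ... | inj₂ (inj₂ (p , q)) = a≁b (Star.map proj₁ q ◅◅ E-sym e ◅ Star.map proj₁ p)

  module _ (F : Graph n) where

    ∈-components⁺ : ∀ {i j} → Star (Adj F) i j → j ∈ block (components F) i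
    ∈-components⁺ = ∈-classes⁺ (walk? (adj? F)) (walk-isEquivalence F)

    ∈-components⁻ : ∀ {i j} → j ∈ block (components F) i → Star (Adj F) i j
    ∈-components⁻ = ∈-classes⁻ (walk? (adj? F)) (walk-isEquivalence F)

-- ID trees without roots

module _ (V : PositiveSet) where

  open import Data.Nat using (_<_)

  private
    n = size V
    lab = label V

  private variable
    E E′ : Rel (Fin n) 0ℓ

  ≤∧≢⇒< : ∀ {u v} → lab u ℕ.≤ lab v → u ≢ v → lab u < lab v
  ≤∧≢⇒< u≤v u≢v = ℕ.≤∧≢⇒< u≤v (u≢v ∘ label-injective V)

  Γ-odd : ∀ {u v} → Adj (Γ V) u v → Odd (lab u) → lab u < lab v × Even (lab v)
  Γ-odd (inj₁ (u<v , _ , v-even)) _     = u<v , v-even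
  Γ-odd (inj₂ (_ , _ , u-even))   u-odd = contradiction u-even u-odd

  Γ-even : ∀ {u v} → Adj (Γ V) u v → Even (lab u) → lab v < lab u × Odd (lab v)
  Γ-even (inj₁ (_ , u-odd , _))   u-even = contradiction u-even u-odd
  Γ-even (inj₂ (v<u , v-odd , _)) _      = v<u , v-odd

  -- A root-free description of the ID forests.  With the edges oᵢeⱼ of Γ
  -- ordered so that small o and large e come first, the last condition
  -- excludes the broken circuits of the 4-cycles.
  record LocallyID (E : Rel (Fin n) 0ℓ) : Set where
    field
      bridges : AllBridges E
      ⊆Γ      : ∀ {u v} → E u v → Adj (Γ V) u v
      ¬broken : ∀ {o e o′ e′} → E o e → E e o′ → E o′ e′ → Odd (lab o) →
                lab o < lab o′ → ¬ lab e < lab e′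

  open LocallyID

  -- Every field excludes certain configurations of edges, and fewer edges produce fewer
  -- configurations. This is the closure under subgraphs that makes the forests a simplicial
  -- complex.
  locallyID-⊆ : E′ ⇒ E → LocallyID E → LocallyID E′
  locallyID-⊆ sub L = record
    { bridges = λ e w → bridges L (sub e) (Star.map (λ { (f , ≢) → sub f , ≢ }) w)
    ; ⊆Γ      = ⊆Γ L ∘ sub
    ; ¬broken = λ p q r → ¬broken L (sub p) (sub q) (sub r)
    }

  module _ {E : Rel (Fin n) 0ℓ} (E-sym : Symmetric E) (E-irrefl : Irreflexive _≡_ E) where

    module _ (acyclic : Acyclic E) {r : Fin n}
             (reach : ∀ {u v} → E u v → Star E r u)
             (conditions : ∀ {u v} → E u v → IDConditions V E r u) where

      private
        -- Whether the path from the root to `u` already passes through `v` decides which end of the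
        -- edge is the parent.
        orient : ∀ {u v} → E u v → Child E r u v ⊎ Child E r v u
        orient {u} {v} e with walk⇒path (reach e)
        ... | p , p! with DecMembership._∈?_ Fin._≟_ v (visits p)
        ...   | yes v∈p = inj₂ (((λ u≡v → E-irrefl u≡v e) , (p , p!) , v∈p) , E-sym e)
        ...   | no  v∉p = let q , p⊆q = path-∷ʳ (p , p!) e v∉p in
                inj₁ (((λ v≡u → E-irrefl (sym v≡u) e) , q , p⊆q (end∈visits p)) , e)

        -- The path from the root to `w` extends to `x`, for if it already contained `x`, then `x`
        -- and `v` would both be the predecessor of `w`.
        child⇒descendant : ∀ {v w x} → Child E r v w → E w x → x ≢ v → Descendant E r v x
        child⇒descendant {v} {w} {x} ((w≢v , (p , p!) , v∈p) , vw) wx x≢v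
          with DecMembership._∈?_ Fin._≟_ x (visits p)
        ... | yes x∈p = contradiction
              (parent-unique acyclic p p! x∈p v∈p wx (E-sym vw)
                (λ x≡w → E-irrefl (sym x≡w) wx) (w≢v ∘ sym)) x≢v
        ... | no  x∉p = let q , p⊆q = path-∷ʳ (p , p!) wx x∉p in x≢v , q , p⊆q v∈p

        child-Γ : ∀ {v w} → Child E r v w → Adj (Γ V) v w
        child-Γ {v} {w} c@(d , e) with even? (lab v) | conditions e
        ... | yes v-even | _ , cond = let down , par = cond v-even in inj₂ (down w d , par w c , v-even)
        ... | no  v-odd  | cond , _ = let up , par = cond v-odd in inj₁ (up w d , v-odd , par w c)

      -- The middle edge of a path o - e - o′ - e′ decides: if `e` is the parent of `o′`, then `e′`
      -- is a descendant of the even node `e` and hence smaller; if `o′` is the parent of `e`, then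
      -- `o` is a descendant of the odd node `o′` and hence greater. The hypotheses concern only
      -- endpoints of edges because in `Induced E S` the vertices outside `S` are isolated and
      -- unreachable.
      rooted⇒locallyID : LocallyID E
      rooted⇒locallyID = record
        { bridges = acyclic⇒bridges E-sym E-irrefl acyclic
        ; ⊆Γ      = edge-Γ
        ; ¬broken = ¬broken′
        }
        where
        edge-Γ : ∀ {u v} → E u v → Adj (Γ V) u v
        edge-Γ e with orient e
        ... | inj₁ c = child-Γ c
        ... | inj₂ c = symm (Γ V) (child-Γ c)

        ¬broken′ : ∀ {o e o′ e′} → E o e → E e o′ → E o′ e′ → Odd (lab o) →
                   lab o < lab o′ → ¬ lab e < lab e′
        ¬broken′ {o} {e} {o′} {e′} oe eo′ o′e′ o-odd o<o′ e<e′ with orient eo′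
        ... | inj₁ c = ℕ.<-asym e<e′ (proj₁ (proj₂ (conditions eo′) e-even) e′
                (child⇒descendant c o′e′ λ { refl → ℕ.<-irrefl refl e<e′ }))
          where e-even = proj₂ (Γ-odd (edge-Γ oe) o-odd)
        ... | inj₂ c = ℕ.<-asym o<o′ (proj₁ (proj₁ (conditions o′e′) o′-odd) o
                (child⇒descendant c (E-sym oe) λ { refl → ℕ.<-irrefl refl o<o′ }))
          where o′-odd = proj₂ (Γ-even (edge-Γ eo′) (proj₂ (Γ-odd (edge-Γ oe) o-odd)))

  -- Strict betweenness of labels for adjacent `x` and `y`: in Γ the parity of `x` tells which of
  -- the two is smaller.
  Between : (x z y : Fin n) → Set
  Between x z y = (Odd  (lab x) → lab x < lab z × lab z < lab y) ×
                  (Even (lab x) → lab y < lab z × lab z < lab x)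

  -- The invariant of an edge traversed away from the root: every continuation turns back into the
  -- interval between its two ends.
  Narrowing : Rel (Fin n) 0ℓ → (x y : Fin n) → Set
  Narrowing E x y = ∀ z → E y z → z ≢ x → Between x z y

  module _ (E-sym : Symmetric E) (L : LocallyID E) where

    -- Adjacency in Γ gives one of the two bounds on `u`. If the other failed, then x - y - z - u,
    -- read from its odd end, would be a broken path, because `N` places `z` between `x` and `y`.
    narrowing-step : ∀ {x y z} → E x y → E y z → z ≢ x → Narrowing E x y → Narrowing E y z
    narrowing-step {x} {y} {z} xy yz z≢x N u zu u≢y = odd-y , even-y
      where
      odd-y : Odd (lab y) → lab y < lab u × lab u < lab z
      odd-y y-odd = ≤∧≢⇒< (ℕ.≮⇒≥ λ u<y → ¬broken L (E-sym zu) (E-sym yz) (E-sym xy) u-odd u<y z<x)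
                          (u≢y ∘ sym) , u<z
        where
        x-even = proj₂ (Γ-odd (⊆Γ L (E-sym xy)) y-odd)
        z<x = proj₂ (proj₂ (N z yz z≢x) x-even)
        u<z = proj₁ (Γ-even (⊆Γ L zu) (proj₂ (Γ-odd (⊆Γ L yz) y-odd)))
        u-odd = proj₂ (Γ-even (⊆Γ L zu) (proj₂ (Γ-odd (⊆Γ L yz) y-odd)))
      even-y : Even (lab y) → lab z < lab u × lab u < lab y
      even-y y-even = z<u , ≤∧≢⇒< (ℕ.≮⇒≥ λ y<u → ¬broken L xy yz zu x-odd x<z y<u) u≢y
        where
        x-odd = proj₂ (Γ-even (⊆Γ L (E-sym xy)) y-even)
        x<z = proj₁ (proj₁ (N z yz z≢x) x-odd)
        z<u = proj₁ (Γ-odd (⊆Γ L zu) (proj₂ (Γ-even (⊆Γ L yz) y-even)))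

    -- Nested intervals: each further step stays strictly inside the interval spanned by the two
    -- vertices before it.
    narrowing-path : ∀ {x y t} → E x y → Narrowing E x y → (w : Star E y t) →
                     Unique (x ∷ visits w) → t ≡ y ⊎ Between x t y
    narrowing-path xy N ε _ = inj₁ refl
    narrowing-path {x} {y} xy N (_◅_ {j = z} yz w) (x∉ ∷ !) =
      inj₂ (lemma (narrowing-path yz (narrowing-step xy yz z≢x N) w !))
      where
      z≢x : z ≢ x
      z≢x z≡x = All.lookup x∉ (there (start∈visits w)) (sym z≡x)
      lemma : ∀ {t} → t ≡ z ⊎ Between y t z → Between x t y
      lemma (inj₁ refl) = N z yz z≢x
      lemma (inj₂ b) =
        (λ x-odd → let z<t , t<y = proj₂ b (proj₂ (Γ-odd (⊆Γ L xy) x-odd)) in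
          ℕ.<-trans (proj₁ (proj₁ (N z yz z≢x) x-odd)) z<t , t<y) ,
        (λ x-even → let y<t , t<z = proj₁ b (proj₂ (Γ-even (⊆Γ L xy) x-even)) in
          y<t , ℕ.<-trans t<z (proj₂ (proj₂ (N z yz z≢x) x-even)))

    -- The invariant is carried along the walk up to `v`; from there `narrowing-path` confines `t`
    -- to one side of `v`, which the parity of `v` names.
    narrowing⇒beyond : ∀ {x y t v} → E x y → Narrowing E x y → (w : Star E y t) →
                       Unique (x ∷ visits w) → v ∈ₗ x ∷ visits w → t ≢ v →
                       (Odd (lab v) → lab v < lab t) × (Even (lab v) → lab t < lab v)
    narrowing⇒beyond xy N w ! (here refl) _ with narrowing-path xy N w !
    ... | inj₁ refl = proj₁ ∘ Γ-odd (⊆Γ L xy) , proj₁ ∘ Γ-even (⊆Γ L xy)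
    ... | inj₂ b    = proj₁ ∘ proj₁ b , proj₂ ∘ proj₂ b
    narrowing⇒beyond xy N ε ! (there (here refl)) t≢v = contradiction refl t≢v
    narrowing⇒beyond {x} xy N (_◅_ {j = z} yz w) (x∉ ∷ !) (there v∈) t≢v =
      narrowing⇒beyond yz (narrowing-step xy yz z≢x N) w ! v∈ t≢v
      where
      z≢x : z ≢ x
      z≢x z≡x = All.lookup x∉ (there (start∈visits w)) (sym z≡x)

    locallyID⇒conditions : ∀ {r} → (∀ {u v} → E u v → lab u ℕ.≤ lab r) → ∀ v → IDConditions V E r v
    locallyID⇒conditions {r} r-max v =
      (λ v-odd → (λ w d → proj₁ (beyond d) v-odd) , λ { w (_ , e) → proj₂ (Γ-odd (⊆Γ L e) v-odd) }) ,
      (λ v-even → (λ w d → proj₂ (beyond d) v-even) , λ { w (_ , e) → proj₂ (Γ-even (⊆Γ L e) v-even) })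
      where
      -- The invariant starts at the root by maximality: a root with a neighbour cannot be odd, and
      -- an even root bounds `z` from above while the odd `y` bounds it from below.
      narrowing-root : ∀ {y} → E r y → Narrowing E r y
      narrowing-root ry z yz z≢r =
        (λ r-odd → contradiction (r-max (E-sym ry)) (ℕ.<⇒≱ (proj₁ (Γ-odd (⊆Γ L ry) r-odd)))) ,
        (λ r-even → proj₁ (Γ-odd (⊆Γ L yz) (proj₂ (Γ-even (⊆Γ L ry) r-even))) ,
                    ≤∧≢⇒< (r-max (E-sym yz)) z≢r)
      beyond : ∀ {w} → Descendant E r v w → (Odd (lab v) → lab v < lab w) × (Even (lab v) → lab w < lab v)
      beyond (w≢v , (ε , _) , here refl) = contradiction refl w≢v
      beyond (w≢v , (e ◅ p , !) , v∈)    = narrowing⇒beyond e (narrowing-root e) p ! v∈ w≢v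

    -- Minimality of `a` starts the narrowing there, so nothing later on the path exceeds the first
    -- neighbour of `a`. The greatest vertex `b` must therefore be that neighbour.
    extremes-adjacent : ∀ {a b} → Odd (lab a) →
      (∀ {z} → Star E a z → lab a ℕ.≤ lab z) → (∀ {z} → Star E a z → lab z ℕ.≤ lab b) →
      a ≢ b → Star E a b → E a b
    extremes-adjacent {a} {b} a-odd a-min b-max a≢b w with walk⇒path w
    ... | ε , _ = contradiction refl a≢b
    ... | ay ◅ p , ! with narrowing-path ay narrowing-a p !
      where
      narrowing-a : Narrowing E a _
      narrowing-a z yz z≢a =
        (λ _ → ≤∧≢⇒< (a-min (ay ◅ yz ◅ ε)) (z≢a ∘ sym) ,
               proj₁ (Γ-even (⊆Γ L yz) (proj₂ (Γ-odd (⊆Γ L ay) a-odd)))) ,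
        (λ a-even → contradiction a-even a-odd)
    ...   | inj₁ refl = ay
    ...   | inj₂ b = contradiction (b-max (ay ◅ ε)) (ℕ.<⇒≱ (proj₂ (proj₁ b a-odd)))

    -- In a new broken path, `ab` as first edge would require `e′` above `b`, and as middle or last
    -- edge `o` below `a`; the reversed positions fail by parity. The bounds are assumed on the
    -- component of `a` in the enlarged graph, so that they cover the former component of `b` too.
    locallyID-∪ : ∀ {a b} → Adj (Γ V) a b → Odd (lab a) →
      (∀ {z} → Star (E ∪⟨ a , b ⟩) a z → lab a ℕ.≤ lab z × lab z ℕ.≤ lab b) →
      ¬ E a b → LocallyID (E ∪⟨ a , b ⟩)
    locallyID-∪ {a} {b} ab a-odd extremes ¬ab = record
      { bridges = bridges-∪ E-sym (bridges L) λ w → ¬ab (extremes-adjacent a-odd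
          (proj₁ ∘ extremes ∘ Star.map inj₁) (proj₂ ∘ extremes ∘ Star.map inj₁)
          (λ a≡b → irrefl (Γ V) a≡b ab) w)
      ; ⊆Γ      = ∪⊆Γ
      ; ¬broken = λ oe eo′ o′e′ o-odd →
          let e-even = proj₂ (Γ-odd (∪⊆Γ oe) o-odd)
              o′-odd = proj₂ (Γ-even (∪⊆Γ eo′) e-even)
          in ¬broken′ oe eo′ o′e′ o-odd e-even o′-odd
      }
      where
      b-even = proj₂ (Γ-odd ab a-odd)
      ∪⊆Γ : ∀ {u v} → (E ∪⟨ a , b ⟩) u v → Adj (Γ V) u v
      ∪⊆Γ (inj₁ e)                    = ⊆Γ L e
      ∪⊆Γ (inj₂ (inj₁ (refl , refl))) = ab
      ∪⊆Γ (inj₂ (inj₂ (refl , refl))) = symm (Γ V) ab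
      ∪-sym : Symmetric (E ∪⟨ a , b ⟩)
      ∪-sym (inj₁ e)        = inj₁ (E-sym e)
      ∪-sym (inj₂ (inj₁ (p , q))) = inj₂ (inj₂ (q , p))
      ∪-sym (inj₂ (inj₂ (p , q))) = inj₂ (inj₁ (q , p))
      ¬broken′ : ∀ {o e o′ e′} → (E ∪⟨ a , b ⟩) o e → (E ∪⟨ a , b ⟩) e o′ → (E ∪⟨ a , b ⟩) o′ e′ →
                 Odd (lab o) → Even (lab e) → Odd (lab o′) → lab o < lab o′ → ¬ lab e < lab e′
      ¬broken′ (inj₁ oe) (inj₁ eo′) (inj₁ o′e′) o-odd _ _ o<o′ = ¬broken L oe eo′ o′e′ o-odd o<o′
      ¬broken′ oe@(inj₂ (inj₁ (refl , refl))) eo′ o′e′ _ _ _ _ e<e′ =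
        ℕ.<⇒≱ e<e′ (proj₂ (extremes (oe ◅ eo′ ◅ o′e′ ◅ ε)))
      ¬broken′ (inj₂ (inj₂ (refl , refl))) _ _ o-odd _ _ _ _ = o-odd b-even
      ¬broken′ (inj₁ _) (inj₂ (inj₁ (refl , refl))) _ _ e-even _ _ _ = a-odd e-even
      ¬broken′ oe@(inj₁ _) eo′@(inj₂ (inj₂ (refl , refl))) _ _ _ _ o<o′ _ =
        ℕ.<⇒≱ o<o′ (proj₁ (extremes (∪-sym eo′ ◅ ∪-sym oe ◅ ε)))
      ¬broken′ oe@(inj₁ _) eo′@(inj₁ _) (inj₂ (inj₁ (refl , refl))) _ _ _ o<o′ _ =
        ℕ.<⇒≱ o<o′ (proj₁ (extremes (∪-sym eo′ ◅ ∪-sym oe ◅ ε)))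
      ¬broken′ (inj₁ _) (inj₁ _) (inj₂ (inj₂ (refl , refl))) _ _ o′-odd _ _ = o′-odd b-even

  module _ {E : Rel (Fin n) 0ℓ} (E-sym : Symmetric E) (E-irrefl : Irreflexive _≡_ E)
           {S : Subset n} where

    private
      induced-sym : Symmetric (Induced E S)
      induced-sym (u∈ , v∈ , e) = v∈ , u∈ , E-sym e

    idTree⇒locallyID : IsIDTree V E S → LocallyID (Induced E S)
    idTree⇒locallyID (((_ , reach) , acyclic) , r , r∈ , _ , conditions) =
      rooted⇒locallyID induced-sym (λ u≡v → E-irrefl u≡v ∘ proj₂ ∘ proj₂) acyclic
        (λ (u∈ , _) → reach r _ r∈ u∈) (λ (u∈ , _) → conditions _ u∈)

    locallyID⇒idTree : ConnectedOn E S → LocallyID (Induced E S) → IsIDTree V E S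
    locallyID⇒idTree connected@(nonempty , _) L =
      let r , r∈ , r-max = ∃-max (Subset._∈? S) lab nonempty in
      (connected , bridges⇒acyclic induced-sym (bridges L)) , r , r∈ , r-max ,
      λ v _ → locallyID⇒conditions induced-sym L (λ (u∈ , _) → r-max _ u∈) v

  module _ (F : Graph n) where

    private
      ∈⁺ : ∀ {u v} → Star (Adj F) u v → v ∈ block (components F) u
      ∈⁺ = ∈-components⁺ F

    idForest⇒locallyID : IsIDForest V F → LocallyID (Adj F)
    idForest⇒locallyID (acyclic , tree) = record
      { bridges = acyclic⇒bridges (symm F) (irrefl F) acyclic
      ; ⊆Γ      = λ {u} e → ⊆Γ (local u) (∈⁺ ε , ∈⁺ (e ◅ ε) , e)
      ; ¬broken = λ {o} oe eo′ o′e′ → ¬broken (local o)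
          (∈⁺ ε , ∈⁺ (oe ◅ ε) , oe)
          (∈⁺ (oe ◅ ε) , ∈⁺ (oe ◅ eo′ ◅ ε) , eo′)
          (∈⁺ (oe ◅ eo′ ◅ ε) , ∈⁺ (oe ◅ eo′ ◅ o′e′ ◅ ε) , o′e′)
      }
      where
      local : ∀ i → LocallyID (Induced (Adj F) (block (components F) i))
      local i = idTree⇒locallyID (symm F) (irrefl F) (tree i)

    locallyID⇒idForest : LocallyID (Adj F) → IsIDForest V F
    locallyID⇒idForest L = bridges⇒acyclic (symm F) (bridges L) , λ i →
      locallyID⇒idTree (symm F) (irrefl F) (component-connected F i)
        (locallyID-⊆ (proj₂ ∘ proj₂) L)

-- The number of blocks of a partition

unique-map⁺ : {f : A → B} {xs : List A} → Unique xs →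
              (∀ {x y} → x ∈ₗ xs → y ∈ₗ xs → f x ≡ f y → x ≡ y) → Unique (List.map f xs)
unique-map⁺ [] _ = []
unique-map⁺ (x∉ ∷ !) inj =
  All.map⁺ (All.tabulate λ y∈ eq → All.lookup x∉ y∈ (inj (here refl) (there y∈) eq)) ∷
  unique-map⁺ ! (λ x∈ y∈ → inj (there x∈) (there y∈))

constant⇒length≤1 : {xs : List A} → Unique xs → (∀ {x y} → x ∈ₗ xs → y ∈ₗ xs → x ≡ y) → length xs ℕ.≤ 1
constant⇒length≤1 []      _ = z≤n
constant⇒length≤1 (_ ∷ []) _ = s≤s z≤n
constant⇒length≤1 ((x≢y ∷ _) ∷ _ ∷ _) eq = contradiction (eq (here refl) (there (here refl))) x≢y

module _ {xs : List A} (xs! : Unique xs) {P Q : Pred A 0ℓ} (P? : U.Decidable P) (Q? : U.Decidable Q)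
         (Q⊆P : ∀ {x} → Q x → P x) {y : A} (y∈ : y ∈ₗ xs) (py : P y) (¬qy : ¬ Q y) where

  length-filter-< : length (filter Q? xs) ℕ.< length (filter P? xs)
  length-filter-< = subst (ℕ._< length (filter P? xs))
    (sym (↭-length (unique∧⊆⊇⇒↭ (Unique.filter⁺ Q? xs!) (Unique.filter⁺ Q? (Unique.filter⁺ P? xs!))
      (λ x∈ → let x∈xs , qx = ∈ₗ.∈-filter⁻ Q? {xs = xs} x∈ in
        ∈ₗ.∈-filter⁺ Q? (∈ₗ.∈-filter⁺ P? x∈xs (Q⊆P qx)) qx)
      (λ x∈ → let x∈fs , qx = ∈ₗ.∈-filter⁻ Q? {xs = filter P? xs} x∈ in
        ∈ₗ.∈-filter⁺ Q? (proj₁ (∈ₗ.∈-filter⁻ P? {xs = xs} x∈fs)) qx))))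
    (List.filter-notAll Q? (filter P? xs) (lose (∈ₗ.∈-filter⁺ P? y∈ py) ¬qy))

  length-filter-suc : (∀ {x} → P x → Q x ⊎ x ≡ y) → length (filter P? xs) ≡ suc (length (filter Q? xs))
  length-filter-suc P⊆Q∪y = ↭-length (unique∧⊆⊇⇒↭ (Unique.filter⁺ P? xs!)
    (All.tabulate (λ x∈ y≡x → ¬qy (subst Q (sym y≡x) (proj₂ (∈ₗ.∈-filter⁻ Q? {xs = xs} x∈)))) ∷ Unique.filter⁺ Q? xs!)
    (λ x∈ → let x∈xs , px = ∈ₗ.∈-filter⁻ P? {xs = xs} x∈ in
      [ there ∘ ∈ₗ.∈-filter⁺ Q? x∈xs , here ]′ (P⊆Q∪y px))
    (λ { (here refl) → ∈ₗ.∈-filter⁺ P? y∈ py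
       ; (there x∈) → let x∈xs , qx = ∈ₗ.∈-filter⁻ Q? {xs = xs} x∈ in ∈ₗ.∈-filter⁺ P? x∈xs (Q⊆P qx) }))

∈-toList⁺ : ∀ {n} (xs : Vec A n) i → Vec.lookup xs i ∈ₗ Vec.toList xs
∈-toList⁺ (x ∷ xs) zero    = here refl
∈-toList⁺ (x ∷ xs) (suc i) = there (∈-toList⁺ xs i)

∈-toList⁻ : ∀ {n} (xs : Vec A n) {x} → x ∈ₗ Vec.toList xs → ∃ λ i → x ≡ Vec.lookup xs i
∈-toList⁻ (x ∷ xs) (here refl) = zero , refl
∈-toList⁻ (x ∷ xs) (there x∈)  = let i , eq = ∈-toList⁻ xs x∈ in suc i , eq

module _ {n : ℕ} where

  module _ (π : Partition n) where

    block-refl : ∀ i → i ∈ block π i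
    block-refl = proj₁ (partition-correct π)

    block-≡ : ∀ {i j} → j ∈ block π i → block π j ≡ block π i
    block-≡ = proj₂ (partition-correct π) _ _

    block-sym : ∀ {i j} → j ∈ block π i → i ∈ block π j
    block-sym {i} j∈ = subst (i ∈_) (sym (block-≡ j∈)) (block-refl i)

    block-trans : ∀ {i j k} → j ∈ block π i → k ∈ block π j → k ∈ block π i
    block-trans {k = k} j∈ k∈ = subst (k ∈_) (block-≡ j∈) k∈

    -- Each block is represented by its least index (not label), so that counting blocks means
    -- filtering `allFin n`, and partitions can be compared through their sets of representatives.
    IsLeast : Pred (Fin n) 0ℓ
    IsLeast i = ∀ j → j ∈ block π i → toℕ i ℕ.≤ toℕ j

    isLeast? : U.Decidable IsLeast
    isLeast? i = Fin.all? λ j → (j Subset.∈? block π i) →-dec (toℕ i ℕ.≤? toℕ j)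

    least : ∀ i → ∃ λ m → m ∈ block π i × IsLeast m
    least i =
      let m , m∈ , m-min = ∃-min (Subset._∈? block π i) toℕ (i , block-refl i)
      in m , m∈ , λ j j∈ → m-min j (block-trans m∈ j∈)

    isLeast-unique : ∀ {i j} → IsLeast i → IsLeast j → j ∈ block π i → i ≡ j
    isLeast-unique {i} {j} i-least j-least j∈ =
      Fin.toℕ-injective (ℕ.≤-antisym (i-least j j∈) (j-least i (block-sym j∈)))

    private
      leasts : List (Fin n)
      leasts = filter isLeast? (allFin n)
      blocks : List (Subset n)
      blocks = Vec.toList (value π)

      leastOf : ∀ {i} → i ∈ₗ leasts → IsLeast i
      leastOf i∈ = proj₂ (∈ₗ.∈-filter⁻ isLeast? {xs = allFin n} i∈)

    ∣∣-leasts : ∣ π ∣ ≡ length leasts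
    ∣∣-leasts = trans
      (sym (↭-length (unique∧⊆⊇⇒↭
        (unique-map⁺ (Unique.filter⁺ isLeast? (Unique.allFin⁺ n)) λ {i} {j} i∈ j∈ eq →
          isLeast-unique (leastOf i∈) (leastOf j∈) (subst (j ∈_) (sym eq) (block-refl j)))
        (DecUnique.deduplicate-! _≟ˢ_ blocks)
        (λ S∈ → let i , i∈ , S≡ = ∈ₗ.∈-map⁻ (block π) S∈ in
          subst (_∈ₗ _) (sym S≡) (∈ₗ.∈-deduplicate⁺ _≟ˢ_ (∈-toList⁺ (value π) i)))
        (λ S∈ → let i , S≡ = ∈-toList⁻ (value π) (∈ₗ.∈-deduplicate⁻ _≟ˢ_ blocks S∈)
                    m , m∈ , m-least = least i in
          subst (_∈ₗ _) (trans (block-≡ m∈) (sym S≡))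
            (∈ₗ.∈-map⁺ (block π) (∈ₗ.∈-filter⁺ isLeast? (∈ₗ.∈-allFin m) m-least))))))
      (List.length-map (block π) leasts)

    ∣∣≤n : ∣ π ∣ ℕ.≤ n
    ∣∣≤n = subst₂ ℕ._≤_ (sym ∣∣-leasts) (List.length-tabulate id) (List.length-filter isLeast? (allFin n))

    ∣∣-allLeast : (∀ i → IsLeast i) → ∣ π ∣ ≡ n
    ∣∣-allLeast all = trans ∣∣-leasts
      (trans (cong length (List.filter-all isLeast? {xs = allFin n} (All.tabulate λ {i} _ → all i))) (List.length-tabulate {n = n} id))

    1≤∣∣ : Fin n → 1 ℕ.≤ ∣ π ∣
    1≤∣∣ i = subst (1 ℕ.≤_) (sym ∣∣-leasts)
      (let m , _ , m-least = least i in List.filter-some isLeast? (lose (∈ₗ.∈-allFin m) m-least))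

    ∣∣≤1 : (∀ i j → j ∈ block π i) → ∣ π ∣ ℕ.≤ 1
    ∣∣≤1 total = subst (ℕ._≤ 1) (sym ∣∣-leasts) (constant⇒length≤1 (Unique.filter⁺ isLeast? (Unique.allFin⁺ n))
      λ {i} {j} i∈ j∈ → isLeast-unique (leastOf i∈) (leastOf j∈) (total i j))

  module _ {σ π : Partition n} where

    private
      module ≤ᵖ = IsDecPartialOrder (≤ᵖ-isDecPartialOrder {n})

    ∈-block-mono : σ ≤ᵖ π → ∀ {i j} → j ∈ block σ i → j ∈ block π i
    ∈-block-mono σ≤π {i} = ≤ᵖ⇒⊆ {n} {σ} {π} σ≤π i

    ⊆⇒≤ᵖ : (∀ {i j} → j ∈ block σ i → j ∈ block π i) → σ ≤ᵖ π
    ⊆⇒≤ᵖ sub i = i , sub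

    partition-ext : (∀ {i j} → j ∈ block σ i → j ∈ block π i) →
                    (∀ {i j} → j ∈ block π i → j ∈ block σ i) → σ ≡ π
    partition-ext f g = ≤ᵖ.antisym {σ} {π} (⊆⇒≤ᵖ f) (λ i → i , g)

    ≢⇒separated : σ ≤ᵖ π → σ ≢ π → ∃ λ i → ∃ λ j → j ∈ block π i × j ∉ block σ i
    ≢⇒separated σ≤π σ≢π with Fin.any? (λ i → Fin.any? λ j →
                               (j Subset.∈? block π i) ×-dec ¬? (j Subset.∈? block σ i))
    ... | yes separated = separated
    ... | no ¬separated = contradiction (partition-ext (∈-block-mono σ≤π) λ {i} {j} j∈ →
            decidable-stable (j Subset.∈? block σ i) λ j∉ → ¬separated (i , j , j∈ , j∉)) σ≢π

    least-antitone : σ ≤ᵖ π → ∀ {i} → IsLeast π i → IsLeast σ i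
    least-antitone σ≤π i-least j j∈ = i-least j (∈-block-mono σ≤π j∈)

    -- Refining a partition keeps all least elements. For `i` and `j` separated by `σ` but not by
    -- `π`, the least elements of their `σ`-blocks are distinct and share a `π`-block, so one of
    -- them is not least in `π`.
    ∣∣-antitone : σ ≤ᵖ π → σ ≢ π → ∣ π ∣ ℕ.< ∣ σ ∣
    ∣∣-antitone σ≤π σ≢π = subst₂ ℕ._<_ (sym (∣∣-leasts π)) (sym (∣∣-leasts σ))
      (let i , j , j∈ , j∉ = ≢⇒separated σ≤π σ≢π
           y , y-least , ¬y-least = lost j∈ j∉
       in length-filter-< (Unique.allFin⁺ n) (isLeast? σ) (isLeast? π)
            (least-antitone σ≤π) (∈ₗ.∈-allFin y) y-least ¬y-least)
      where
      lost : ∀ {i j} → j ∈ block π i → j ∉ block σ i → ∃ λ y → IsLeast σ y × ¬ IsLeast π y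
      lost {i} {j} j∈ j∉ with least σ i | least σ j
      ... | k , k∈ , k-least | l , l∈ , l-least with isLeast? π k | isLeast? π l
      ...   | no ¬k  | _      = k , k-least , ¬k
      ...   | yes _  | no ¬l  = l , l-least , ¬l
      ...   | yes k! | yes l! = contradiction
              (block-trans σ k∈ (subst (λ m → j ∈ block σ m) (sym k≡l) (block-sym σ l∈))) j∉
        where
        k≡l = isLeast-unique π k! l! (block-trans π (block-sym π (∈-block-mono σ≤π k∈))
                (block-trans π j∈ (∈-block-mono σ≤π l∈)))

    -- Merging the blocks of `a` and `b` costs exactly one least element, the greater of their two;
    -- `ordered` treats one order and the other follows by exchanging `a` and `b`.
    ∣∣-merge : σ ≤ᵖ π → ∀ {a b} → b ∈ block π a → b ∉ block σ a →
      (∀ {i j} → j ∈ block π i → j ∈ block σ i ⊎ (i ∈ block σ a × j ∈ block σ b)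
                                               ⊎ (i ∈ block σ b × j ∈ block σ a)) →
      ∣ σ ∣ ≡ suc ∣ π ∣
    ∣∣-merge σ≤π {a} {b} b∈ b∉ merged = trans (∣∣-leasts σ)
      (trans count (cong suc (sym (∣∣-leasts π))))
      where
      Count : Set
      Count = length (filter (isLeast? σ) (allFin n)) ≡ suc (length (filter (isLeast? π) (allFin n)))

      ordered : ∀ {a b k l} → b ∈ block π a → b ∉ block σ a →
        (∀ {i j} → j ∈ block π i → j ∈ block σ i ⊎ (i ∈ block σ a × j ∈ block σ b)
                                                 ⊎ (i ∈ block σ b × j ∈ block σ a)) →
        k ∈ block σ a → IsLeast σ k → l ∈ block σ b → IsLeast σ l → toℕ k ℕ.< toℕ l → Count
      ordered {a} {b} {k} {l} b∈ b∉ merged k∈ k-least l∈ l-least k<l =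
        length-filter-suc (Unique.allFin⁺ n) (isLeast? σ) (isLeast? π)
          (least-antitone σ≤π) (∈ₗ.∈-allFin l) l-least
          (λ l-least′ → ℕ.<⇒≱ k<l (l-least′ k (block-trans π (block-sym π (∈-block-mono σ≤π l∈))
                          (block-trans π (block-sym π b∈) (∈-block-mono σ≤π k∈)))))
          still
        where
        still : ∀ {i} → IsLeast σ i → IsLeast π i ⊎ i ≡ l
        still {i} i-least with i Subset.∈? block σ b
        ... | yes i∈b = inj₂ (isLeast-unique σ i-least l-least (block-trans σ (block-sym σ i∈b) l∈))
        ... | no  i∉b = inj₁ λ j j∈ → [ i-least j , [
                (λ (i∈a , j∈b) → ℕ.≤-trans (i-least k (block-trans σ (block-sym σ i∈a) k∈))
                  (ℕ.≤-trans (ℕ.<⇒≤ k<l) (l-least j (block-trans σ (block-sym σ l∈) j∈b)))) ,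
                (λ (i∈b , _) → contradiction i∈b i∉b) ]′ ]′ (merged j∈)

      count : Count
      count with least σ a | least σ b
      ... | k , k∈ , k-least | l , l∈ , l-least with ℕ.<-cmp (toℕ k) (toℕ l)
      ...   | tri< k<l _ _ = ordered b∈ b∉ merged k∈ k-least l∈ l-least k<l
      ...   | tri> _ _ l<k = ordered (block-sym π b∈) (b∉ ∘ block-sym σ)
                (Sum.map₂ Sum.swap ∘ merged) l∈ l-least k∈ k-least l<k
      ...   | tri≈ _ k≡l _ = contradiction
                (block-trans σ k∈ (subst (λ m → b ∈ block σ m) (sym (Fin.toℕ-injective k≡l)) (block-sym σ l∈))) b∉

-- Toggling an edge

lookup-ext : ∀ {A : Set} {n} {xs ys : Vec A n} → (∀ i → Vec.lookup xs i ≡ Vec.lookup ys i) → xs ≡ ys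
lookup-ext {xs = xs} {ys} eq = trans (sym (Vec.tabulate∘lookup xs))
  (trans (Vec.tabulate-cong eq) (Vec.tabulate∘lookup ys))

module _ {n : ℕ} where

  adjacency-ext : {M N : AdjacencyMatrix n} → Adj (graph M) ⇒ Adj (graph N) →
                  Adj (graph N) ⇒ Adj (graph M) → M ≡ N
  adjacency-ext f g = value-injective (lookup-ext λ i → Subset.⊆-antisym f g)

  module _ {E : Rel (Fin n) 0ℓ} (E? : B.Decidable E) (E-sym : Symmetric E) (E-irrefl : Irreflexive _≡_ E) where

    private
      M : Vec (Subset n) n
      M = tabulate λ i → fromDec (E? i)

      ∈⁺ : ∀ {i j} → E i j → j ∈ Vec.lookup M i
      ∈⁺ {i} {j} e = subst (j ∈_) (sym (Vec.lookup∘tabulate _ i)) (∈-fromDec⁺ (E? i) e)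

      ∈⁻ : ∀ {i j} → j ∈ Vec.lookup M i → E i j
      ∈⁻ {i} {j} j∈ = ∈-fromDec⁻ (E? i) (subst (j ∈_) (Vec.lookup∘tabulate _ i) j∈)

    adjacencyMatrix : AdjacencyMatrix n
    adjacencyMatrix = M ,ᵣ [ (λ i j → ∈⁺ ∘ E-sym ∘ ∈⁻) , (λ i → E-irrefl refl ∘ ∈⁻) ]

    adjacencyMatrix⁺ : E ⇒ Adj (graph adjacencyMatrix)
    adjacencyMatrix⁺ = ∈⁺

    adjacencyMatrix⁻ : Adj (graph adjacencyMatrix) ⇒ E
    adjacencyMatrix⁻ = ∈⁻

  emptyGraph : AdjacencyMatrix n
  emptyGraph = adjacencyMatrix {E = λ _ _ → ⊥} (λ _ _ → no id) id (λ _ → id)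

  ¬emptyGraph-adj : ∀ {i j} → ¬ Adj (graph emptyGraph) i j
  ¬emptyGraph-adj = adjacencyMatrix⁻ {E = λ _ _ → ⊥} (λ _ _ → no id) id (λ _ → id)

  sameEdge? : (a b : Fin n) → B.Decidable (SameEdge a b)
  sameEdge? a b u v = ((u Fin.≟ a) ×-dec (v Fin.≟ b)) ⊎-dec ((u Fin.≟ b) ×-dec (v Fin.≟ a))

  module _ (F : Graph n) where

    module _ {π : Partition n} where

      walk-in-block : Adj F ⇒ (λ i j → j ∈ block π i) → Star (Adj F) ⇒ (λ i j → j ∈ block π i)
      walk-in-block sub ε       = block-refl π _
      walk-in-block sub (e ◅ w) = block-trans π (sub e) (walk-in-block sub w)

      components-≤⁺ : Adj F ⇒ (λ i j → j ∈ block π i) → components F ≤ᵖ π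
      components-≤⁺ sub = ⊆⇒≤ᵖ {σ = components F} {π} λ j∈ → walk-in-block sub (∈-components⁻ F j∈)

      components-≤⁻ : components F ≤ᵖ π → Star (Adj F) ⇒ (λ i j → j ∈ block π i)
      components-≤⁻ F≤π w = ∈-block-mono {σ = components F} {π} F≤π (∈-components⁺ F w)

  module _ {a b : Fin n} (a≢b : a ≢ b) where

    private module _ (M : AdjacencyMatrix n) where
      F = graph M

      ∪-dec : B.Decidable (Adj F ∪⟨ a , b ⟩)
      ∪-dec u v = adj? F u v ⊎-dec sameEdge? a b u v

      ∪-irrefl : Irreflexive _≡_ (Adj F ∪⟨ a , b ⟩)
      ∪-irrefl refl (inj₁ e)                    = irrefl F refl e
      ∪-irrefl refl (inj₂ (inj₁ (refl , refl))) = a≢b refl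
      ∪-irrefl refl (inj₂ (inj₂ (refl , refl))) = a≢b refl

      ∪-sym : Symmetric (Adj F ∪⟨ a , b ⟩)
      ∪-sym (inj₁ e)              = inj₁ (symm F e)
      ∪-sym (inj₂ (inj₁ (p , q))) = inj₂ (inj₂ (q , p))
      ∪-sym (inj₂ (inj₂ (p , q))) = inj₂ (inj₁ (q , p))

      ∖-dec : B.Decidable (Adj F ∖⟨ a , b ⟩)
      ∖-dec u v = adj? F u v ×-dec ¬? (sameEdge? a b u v)

    addEdge removeEdge toggleEdge : AdjacencyMatrix n → AdjacencyMatrix n
    addEdge M = adjacencyMatrix (∪-dec M) (∪-sym M) (∪-irrefl M)
    removeEdge M = adjacencyMatrix (∖-dec M) (∖-symmetric (symm (graph M))) (λ eq → irrefl (graph M) eq ∘ proj₁)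
    toggleEdge M with adj? (graph M) a b
    ... | yes _ = removeEdge M
    ... | no  _ = addEdge M

    addEdge⁺ : ∀ M → (Adj (graph M) ∪⟨ a , b ⟩) ⇒ Adj (graph (addEdge M))
    addEdge⁺ M = adjacencyMatrix⁺ (∪-dec M) (∪-sym M) (∪-irrefl M)

    addEdge⁻ : ∀ M → Adj (graph (addEdge M)) ⇒ (Adj (graph M) ∪⟨ a , b ⟩)
    addEdge⁻ M = adjacencyMatrix⁻ (∪-dec M) (∪-sym M) (∪-irrefl M)

    removeEdge⁺ : ∀ M → (Adj (graph M) ∖⟨ a , b ⟩) ⇒ Adj (graph (removeEdge M))
    removeEdge⁺ M = adjacencyMatrix⁺ (∖-dec M) (∖-symmetric (symm (graph M))) (λ eq → irrefl (graph M) eq ∘ proj₁)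

    removeEdge⁻ : ∀ M → Adj (graph (removeEdge M)) ⇒ (Adj (graph M) ∖⟨ a , b ⟩)
    removeEdge⁻ M = adjacencyMatrix⁻ (∖-dec M) (∖-symmetric (symm (graph M))) (λ eq → irrefl (graph M) eq ∘ proj₁)

    addEdge-adj : ∀ M → Adj (graph (addEdge M)) a b
    addEdge-adj M = addEdge⁺ M (inj₂ (inj₁ (refl , refl)))

    ¬removeEdge-adj : ∀ M → ¬ Adj (graph (removeEdge M)) a b
    ¬removeEdge-adj M e = proj₂ (removeEdge⁻ M e) (inj₁ (refl , refl))

    addEdge∘removeEdge : ∀ M → Adj (graph M) a b → addEdge (removeEdge M) ≡ M
    addEdge∘removeEdge M ab = adjacency-ext {M = addEdge (removeEdge M)} {M}
      (λ e → [ proj₁ ∘ removeEdge⁻ M , same ]′ (addEdge⁻ (removeEdge M) e)) restore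
      where
      same : SameEdge a b ⇒ Adj (graph M)
      same (inj₁ (refl , refl)) = ab
      same (inj₂ (refl , refl)) = symm (graph M) ab
      restore : Adj (graph M) ⇒ Adj (graph (addEdge (removeEdge M)))
      restore {u} {v} e with sameEdge? a b u v
      ... | yes s = addEdge⁺ (removeEdge M) (inj₂ s)
      ... | no ≢  = addEdge⁺ (removeEdge M) (inj₁ (removeEdge⁺ M (e , ≢)))

    ¬adj⇒¬sameEdge : ∀ M → ¬ Adj (graph M) a b → ∀ {u v} → Adj (graph M) u v → ¬ SameEdge a b u v
    ¬adj⇒¬sameEdge M ¬ab e (inj₁ (refl , refl)) = ¬ab e
    ¬adj⇒¬sameEdge M ¬ab e (inj₂ (refl , refl)) = ¬ab (symm (graph M) e)

    removeEdge∘addEdge : ∀ M → ¬ Adj (graph M) a b → removeEdge (addEdge M) ≡ M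
    removeEdge∘addEdge M ¬ab = adjacency-ext {M = removeEdge (addEdge M)} {M}
      (λ e → let f , ≢ = removeEdge⁻ (addEdge M) e in
        [ id , (λ s → contradiction s ≢) ]′ (addEdge⁻ M f))
      (λ e → removeEdge⁺ (addEdge M) (addEdge⁺ M (inj₁ e) , ¬adj⇒¬sameEdge M ¬ab e))

    toggleEdge-adj : ∀ M → Adj (graph M) a b → toggleEdge M ≡ removeEdge M
    toggleEdge-adj M ab with adj? (graph M) a b
    ... | yes _  = refl
    ... | no ¬ab = contradiction ab ¬ab

    toggleEdge-¬adj : ∀ M → ¬ Adj (graph M) a b → toggleEdge M ≡ addEdge M
    toggleEdge-¬adj M ¬ab with adj? (graph M) a b
    ... | yes ab = contradiction ab ¬ab
    ... | no  _  = refl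

    toggleEdge-involutive : ∀ M → toggleEdge (toggleEdge M) ≡ M
    toggleEdge-involutive M = case (adj? (graph M) a b)
      where
      case : Dec (Adj (graph M) a b) → toggleEdge (toggleEdge M) ≡ M
      case (yes ab) = trans (cong toggleEdge (toggleEdge-adj M ab))
        (trans (toggleEdge-¬adj (removeEdge M) (¬removeEdge-adj M)) (addEdge∘removeEdge M ab))
      case (no ¬ab) = trans (cong toggleEdge (toggleEdge-¬adj M ¬ab))
        (trans (toggleEdge-adj (addEdge M) (addEdge-adj M)) (removeEdge∘addEdge M ¬ab))

    -- The case of a graph containing `ab` is the premise for the graph with `ab` removed, read
    -- backwards.
    toggleEdge-signReversing : (f : AdjacencyMatrix n → ℤ) →
      (∀ M → ¬ Adj (graph M) a b → f (addEdge M) ≡ - f M) → ∀ M → f (toggleEdge M) ≡ - f M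
    toggleEdge-signReversing f f-add M = case (adj? (graph M) a b)
      where
      case : Dec (Adj (graph M) a b) → f (toggleEdge M) ≡ - f M
      case (yes ab) = trans (cong f (toggleEdge-adj M ab))
        (sym (trans (cong (-_ ∘ f) (sym (addEdge∘removeEdge M ab)))
          (trans (cong -_ (f-add (removeEdge M) (¬removeEdge-adj M))) (ℤ.neg-involutive _))))
      case (no ¬ab) = trans (cong f (toggleEdge-¬adj M ¬ab)) (f-add M ¬ab)

    ∣components∣-addEdge : ∀ M → ¬ Star (Adj (graph M)) a b →
      ∣ components (graph M) ∣ ≡ suc ∣ components (graph (addEdge M)) ∣
    ∣components∣-addEdge M a≁b = ∣∣-merge {σ = σ} {π}
      (components-≤⁺ (graph M) {π} λ e → ∈-components⁺ (graph (addEdge M)) (addEdge⁺ M (inj₁ e) ◅ ε))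
      (∈-components⁺ (graph (addEdge M)) (addEdge-adj M ◅ ε))
      (a≁b ∘ ∈-components⁻ (graph M))
      λ j∈ → Sum.map ∈⁺ (Sum.map (λ (p , q) → ∈⁺ (rev p) , ∈⁺ q) (λ (p , q) → ∈⁺ (rev p) , ∈⁺ q))
               (∪-walk⁻ (symm (graph M)) (Star.map (addEdge⁻ M) (∈-components⁻ (graph (addEdge M)) j∈)))
      where
      σ = components (graph M)
      π = components (graph (addEdge M))
      ∈⁺ = ∈-components⁺ (graph M)
      rev : ∀ {i j} → Star (Adj (graph M)) i j → Star (Adj (graph M)) j i
      rev = Star.reverse (symm (graph M))

-- The cone of ID forests inside a bond partition

module _ (V : PositiveSet) where

  open import Data.Nat using (_<_)

  private
    n = size V
    lab = label V

  -- The edge ab is the apex of the cone of ID forests inside π.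
  record Apex (π : Partition n) : Set where
    field
      {a b}    : Fin n
      b∈block  : b ∈ block π a
      a-odd    : Odd (lab a)
      Γ-ab     : Adj (Γ V) a b
      extremal : ∀ {z} → z ∈ block π a → lab a ℕ.≤ lab z × lab z ℕ.≤ lab b

    a≢b : a ≢ b
    a≢b a≡b = irrefl (Γ V) a≡b Γ-ab

  -- Connectedness gives the least and the greatest vertex of the block neighbours inside it. In Γ
  -- even vertices have only smaller neighbours and odd ones only greater, so the least is odd, the
  -- greatest even, and the two are adjacent.
  apex : ∀ {π} → IsBond (Γ V) π → ∀ {i j} → j ∈ block π i → j ≢ i → Apex π
  apex {π} bond {i} {j} j∈ j≢i = record
    { b∈block  = block-trans π (block-sym π a∈) b∈
    ; a-odd    = a-odd
    ; Γ-ab     = inj₁ (a<b , a-odd , b-even)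
    ; extremal = λ z∈ → let z∈i = block-trans π a∈ z∈ in a-min _ z∈i , b-max _ z∈i
    }
    where
    min = ∃-min (Subset._∈? block π i) lab (i , block-refl π i)
    max = ∃-max (Subset._∈? block π i) lab (i , block-refl π i)
    a = proj₁ min
    b = proj₁ max
    a∈ = proj₁ (proj₂ min)
    b∈ = proj₁ (proj₂ max)
    a-min = proj₂ (proj₂ min)
    b-max = proj₂ (proj₂ max)
    a<b : lab a < lab b
    a<b = ℕ.≰⇒> λ b≤a → j≢i (label-injective V (ℕ.≤-antisym
      (ℕ.≤-trans (b-max j j∈) (ℕ.≤-trans b≤a (a-min i (block-refl π i))))
      (ℕ.≤-trans (b-max i (block-refl π i)) (ℕ.≤-trans b≤a (a-min j j∈)))))
    neighbour : ∀ {u v} → u ∈ block π i → v ∈ block π i → u ≢ v →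
                ∃ λ x → x ∈ block π i × Adj (Γ V) u x
    neighbour u∈ v∈ u≢v with proj₂ (bond i) _ _ u∈ v∈
    ... | ε = contradiction refl u≢v
    ... | (_ , x∈ , e) ◅ _ = _ , x∈ , e
    a≢b : a ≢ b
    a≢b a≡b = ℕ.<-irrefl (cong lab a≡b) a<b
    a-odd : Odd (lab a)
    a-odd a-even = let x , x∈ , ax = neighbour a∈ b∈ a≢b in
      ℕ.<⇒≱ (proj₁ (Γ-even V ax a-even)) (a-min x x∈)
    b-even : Even (lab b)
    b-even with even? (lab b)
    ... | yes b-even = b-even
    ... | no  b-odd  = let x , x∈ , bx = neighbour b∈ a∈ (a≢b ∘ sym) in
      contradiction (b-max x x∈) (ℕ.<⇒≱ (proj₁ (Γ-odd V bx b-odd)))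

  -- These are the forests that remain when `#IDForestsOnBlocks` is summed over all bond partitions
  -- below `π`.
  IDForestWithin : Partition n → Pred (AdjacencyMatrix n) 0ℓ
  IDForestWithin π M = IsIDForest V (graph M) × components (graph M) ≤ᵖ π

  idForestWithin? : ∀ π → U.Decidable (IDForestWithin π)
  idForestWithin? π M = isIDForest? V (graph M) ×-dec components (graph M) ≤ᵖ? π

  module _ {π : Partition n} (A : Apex π) (M : AdjacencyMatrix n) where

    open Apex A
    open LocallyID

    private
      F = graph M
      F⁺ = graph (addEdge a≢b M)

    module _ (¬ab : ¬ Adj F a b) where

      within-addEdge⁺ : IDForestWithin π M → IDForestWithin π (addEdge a≢b M)
      within-addEdge⁺ (forest , F≤π) =
        locallyID⇒idForest V F⁺ (locallyID-⊆ V (addEdge⁻ a≢b M)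
          (locallyID-∪ V (symm F) (idForest⇒locallyID V F forest) Γ-ab a-odd
            -- The enlarged component of `a` still lies in the block of `a` in `π`, where `a` and
            -- `b` are extremal.
            (extremal ∘ components-≤⁻ F⁺ {π} F⁺≤π ∘ Star.map (addEdge⁺ a≢b M)) ¬ab)) ,
        F⁺≤π
        where
        F⁺≤π : components F⁺ ≤ᵖ π
        F⁺≤π = components-≤⁺ F⁺ {π} λ e → case (addEdge⁻ a≢b M e)
          where
          case : (Adj F ∪⟨ a , b ⟩) ⇒ (λ i j → j ∈ block π i)
          case (inj₁ e)                    = components-≤⁻ F {π} F≤π (e ◅ ε)
          case (inj₂ (inj₁ (refl , refl))) = b∈block
          case (inj₂ (inj₂ (refl , refl))) = block-sym π b∈block

      within-addEdge⁻ : IDForestWithin π (addEdge a≢b M) → IDForestWithin π M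
      within-addEdge⁻ (forest , F⁺≤π) =
        locallyID⇒idForest V F (locallyID-⊆ V (addEdge⁺ a≢b M ∘ inj₁) (idForest⇒locallyID V F⁺ forest)) ,
        components-≤⁺ F {π} λ e → components-≤⁻ F⁺ {π} F⁺≤π (addEdge⁺ a≢b M (inj₁ e) ◅ ε)

      -- `ab` is a bridge of the larger forest, so without it `a` and `b` lie in different
      -- components.
      within-∣components∣ : IDForestWithin π (addEdge a≢b M) → ∣ components F ∣ ≡ suc ∣ components F⁺ ∣
      within-∣components∣ (forest , _) = ∣components∣-addEdge a≢b M λ w →
        bridges (idForest⇒locallyID V F⁺ forest) (addEdge-adj a≢b M)
          (Star.map (λ e → addEdge⁺ a≢b M (inj₁ e) , ¬adj⇒¬sameEdge a≢b M ¬ab e) w)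

  ∑-within≡0 : ∀ {π} → Apex π →
    ∑ℤ (elements (adjacencyMatrices n))
       (λ M → ⟦ idForestWithin? π M ⟧ * -1ℤ ^ ∣ components (graph M) ∣) ≡ 0ℤ
  ∑-within≡0 {π} A = ∑-signReversing (adjacencyMatrices n) _ (toggleEdge a≢b) (toggleEdge-involutive a≢b)
    (toggleEdge-signReversing a≢b (λ M → ⟦ idForestWithin? π M ⟧ * -1ℤ ^ ∣ components (graph M) ∣)
      λ M ¬ab → ⟦⟧*-1^-negate (idForestWithin? π M) (idForestWithin? π (addEdge a≢b M))
        (within-addEdge⁺ A M ¬ab) (within-addEdge⁻ A M ¬ab) (within-∣components∣ A M ¬ab))
    where open Apex A

  -- All edges of an ID forest belong to Γ. Hence summing over bond partitions alone misses no ID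
  -- forest.
  idForest⇒bond : ∀ F → IsIDForest V F → IsBond (Γ V) (components F)
  idForest⇒bond F forest i = let nonempty , reach = component-connected F i in
    nonempty , λ u v u∈ v∈ → Star.map
      (λ (s∈ , t∈ , e) → s∈ , t∈ , LocallyID.⊆Γ (idForest⇒locallyID V F forest) e) (reach u v u∈ v∈)

  bonds : Enumeration (BondPartition (Γ V))
  bonds = FinitePoset.enumeration (Π (Γ V))

  ∑-bonds : (g : Partition n → ℤ) →
    ∑ℤ (elements bonds) (λ σ → g (value σ) * + #IDForestsOnBlocks V (value σ)) ≡
    ∑ℤ (elements (adjacencyMatrices n)) (λ M → ⟦ isIDForest? V (graph M) ⟧ * g (components (graph M)))
  ∑-bonds g = ∑-fibres bonds (adjacencyMatrices n) (λ M → isIDForest? V (graph M)) _≟ᵖ_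
    (λ M → components (graph M)) value value-injective
    (λ M forest → (components (graph M) ,ᵣ [ idForest⇒bond (graph M) forest ]) , refl) g

-- Covers in the bond lattice

module _ {n : ℕ} (π : Partition n) (x : Fin n) where

  SplitOff : Rel (Fin n) 0ℓ
  SplitOff i j = i ≡ j ⊎ (j ∈ block π i × i ≢ x × j ≢ x)

  splitOff? : B.Decidable SplitOff
  splitOff? i j = (i Fin.≟ j) ⊎-dec ((j Subset.∈? block π i) ×-dec ¬? (i Fin.≟ x) ×-dec ¬? (j Fin.≟ x))

  splitOff-isEquivalence : IsEquivalence SplitOff
  splitOff-isEquivalence = record
    { refl  = inj₁ refl
    ; sym   = λ { (inj₁ refl) → inj₁ refl ; (inj₂ (j∈ , i≢ , j≢)) → inj₂ (block-sym π j∈ , j≢ , i≢) }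
    ; trans = λ { (inj₁ refl) q → q ; p (inj₁ refl) → p
                ; (inj₂ (j∈ , i≢ , _)) (inj₂ (k∈ , _ , k≢)) → inj₂ (block-trans π j∈ k∈ , i≢ , k≢) }
    }

  splitOff : Partition n
  splitOff = classes splitOff? splitOff-isEquivalence

  splitOff⁺ : ∀ {i j} → SplitOff i j → j ∈ block splitOff i
  splitOff⁺ = ∈-classes⁺ splitOff? splitOff-isEquivalence

  splitOff⁻ : ∀ {i j} → j ∈ block splitOff i → SplitOff i j
  splitOff⁻ = ∈-classes⁻ splitOff? splitOff-isEquivalence

  splitOff-≤ : splitOff ≤ᵖ π
  splitOff-≤ = ⊆⇒≤ᵖ {σ = splitOff} {π} λ j∈ → [ (λ { refl → block-refl π _ }) , proj₁ ]′ (splitOff⁻ j∈)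

  module _ {k : Fin n} (k∈ : k ∈ block π x) (k≢x : k ≢ x) where

    ∣splitOff∣ : ∣ splitOff ∣ ≡ suc ∣ π ∣
    ∣splitOff∣ = ∣∣-merge {σ = splitOff} {π} splitOff-≤ k∈
      ([ (λ x≡k → k≢x (sym x≡k)) , (λ (_ , x≢x , _) → x≢x refl) ]′ ∘ splitOff⁻) merged
      where
      merged : ∀ {i j} → j ∈ block π i → j ∈ block splitOff i
        ⊎ (i ∈ block splitOff x × j ∈ block splitOff k) ⊎ (i ∈ block splitOff k × j ∈ block splitOff x)
      merged {i} {j} j∈ with i Fin.≟ x | j Fin.≟ x
      ... | yes refl | yes refl = inj₁ (block-refl splitOff i)
      ... | yes refl | no j≢x   = inj₂ (inj₁ (block-refl splitOff i ,
              splitOff⁺ (inj₂ (block-trans π (block-sym π k∈) j∈ , k≢x , j≢x))))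
      ... | no i≢x | yes refl   = inj₂ (inj₂
              (splitOff⁺ (inj₂ (block-trans π (block-sym π k∈) (block-sym π j∈) , k≢x , i≢x)) ,
               block-refl splitOff j))
      ... | no i≢x | no j≢x     = inj₁ (splitOff⁺ (inj₂ (j∈ , i≢x , j≢x)))

  module _ (G : Graph n) (bond : IsBond G π) where

    -- Only the rest of the block of `x` needs the hypothesis: `x` itself becomes a singleton and
    -- all other blocks are unchanged.
    splitOff-isBond :
      (∀ {i} → i ∈ block π x → i ≢ x → ∀ u v → SplitOff i u → SplitOff i v →
        Star (λ s t → SplitOff i s × SplitOff i t × Adj G s t) u v) →
      IsBond G splitOff
    splitOff-isBond connected i = (i , block-refl splitOff i) , λ u v u∈ v∈ →
      Star.map (λ (s , t , e) → splitOff⁺ s , splitOff⁺ t , e) (walk (splitOff⁻ u∈) (splitOff⁻ v∈))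
      where
      walk : ∀ {u v} → SplitOff i u → SplitOff i v → Star (λ s t → SplitOff i s × SplitOff i t × Adj G s t) u v
      walk {u} {v} u∼ v∼ with i Fin.≟ x | i Subset.∈? block π x
      ... | no i≢x | yes i∈ = connected i∈ i≢x u v u∼ v∼
      ... | yes refl | _ with u∼ | v∼
      ...   | inj₁ refl | inj₁ refl = ε
      ...   | inj₂ (_ , i≢i , _) | _ = contradiction refl i≢i
      ...   | _ | inj₂ (_ , i≢i , _) = contradiction refl i≢i
      walk {u} {v} u∼ v∼ | no i≢x | no i∉ =
        Star.map (λ (s∈ , t∈ , e) → coarse s∈ , coarse t∈ , e) (proj₂ (bond i) u v (fine u∼) (fine v∼))
        where
        fine : ∀ {s} → SplitOff i s → s ∈ block π i
        fine s∼ = ∈-block-mono {σ = splitOff} {π} splitOff-≤ (splitOff⁺ s∼)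
        coarse : ∀ {s} → s ∈ block π i → SplitOff i s
        coarse s∈ = inj₂ (s∈ , i≢x , λ { refl → i∉ (block-sym π s∈) })

-- Möbius function and rank of the bond lattice

module _ (V : PositiveSet) where

  private
    n = size V
    lab = label V
    Ms = adjacencyMatrices n

  open FinitePoset (Π (Γ V))

  -- Inside a block with apex ab every even vertex is adjacent to a and every
  -- odd one to b, so any third vertex can be split off.
  bond-cover : ∀ {π} → IsBond (Γ V) π → Apex V π →
               ∃ λ σ → IsBond (Γ V) σ × σ ≤ᵖ π × ∣ σ ∣ ≡ suc ∣ π ∣
  bond-cover {π} bond A = choose (Fin.any? λ x →
      (x Subset.∈? block π a) ×-dec ¬? (x Fin.≟ a) ×-dec ¬? (x Fin.≟ b))
    where
    open Apex A
    b-even : Even (lab b)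
    b-even = proj₂ (Γ-odd V Γ-ab a-odd)

    choose : Dec (∃ λ x → x ∈ block π a × x ≢ a × x ≢ b) →
             ∃ λ σ → IsBond (Γ V) σ × σ ≤ᵖ π × ∣ σ ∣ ≡ suc ∣ π ∣
    choose (yes (x , x∈ , x≢a , x≢b)) = splitOff π x ,
      splitOff-isBond π x (Γ V) bond (λ i∈ i≢x u v u∼ v∼ →
        to-a i∈ i≢x u∼ ◅◅ Star.reverse (λ (s , t , e) → t , s , symm (Γ V) e) (to-a i∈ i≢x v∼)) ,
      splitOff-≤ π x , ∣splitOff∣ π x (block-sym π x∈) (x≢a ∘ sym)
      where
      module _ {i} (i∈ : i ∈ block π x) (i≢x : i ≢ x) where
        a∼ : SplitOff π x i a
        a∼ = inj₂ (block-trans π (block-sym π i∈) (block-sym π x∈) , i≢x , x≢a ∘ sym)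
        b∼ : SplitOff π x i b
        b∼ = inj₂ (block-trans π (block-sym π i∈) (block-trans π (block-sym π x∈) b∈block) , i≢x , x≢b ∘ sym)
        to-a : ∀ {u} → SplitOff π x i u → Star (λ s t → SplitOff π x i s × SplitOff π x i t × Adj (Γ V) s t) u a
        to-a {u} u∼ with even? (lab u)
        ... | yes u-even = (u∼ , a∼ , inj₂ (≤∧≢⇒< V (proj₁ (extremal u∈a)) (λ { refl → a-odd u-even }) , a-odd , u-even)) ◅ ε
          where
          u∈a : u ∈ block π a
          u∈a = block-trans π x∈ (block-trans π i∈ (∈-block-mono {σ = splitOff π x} {π} (splitOff-≤ π x) (splitOff⁺ π x u∼)))
        ... | no u-odd = (u∼ , b∼ , inj₁ (≤∧≢⇒< V (proj₂ (extremal u∈a)) (λ { refl → u-odd b-even }) , u-odd , b-even)) ◅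
                         (b∼ , a∼ , symm (Γ V) Γ-ab) ◅ ε
          where
          u∈a : u ∈ block π a
          u∈a = block-trans π x∈ (block-trans π i∈ (∈-block-mono {σ = splitOff π x} {π} (splitOff-≤ π x) (splitOff⁺ π x u∼)))
    -- Here the block is just the edge `ab`, and splitting off `a` leaves the singleton of `b`.
    choose (no ¬third) = splitOff π a ,
      splitOff-isBond π a (Γ V) bond (λ i∈ i≢a u v u∼ v∼ →
        subst (Star _ u) (trans (≡b i∈ i≢a u∼) (sym (≡b i∈ i≢a v∼))) ε) ,
      splitOff-≤ π a , ∣splitOff∣ π a b∈block (a≢b ∘ sym)
      where
      only-b : ∀ {s} → s ∈ block π a → s ≢ a → s ≡ b
      only-b {s} s∈ s≢a with s Fin.≟ b
      ... | yes s≡b = s≡b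
      ... | no  s≢b = contradiction (s , s∈ , s≢a , s≢b) ¬third
      ≡b : ∀ {i s} → i ∈ block π a → i ≢ a → SplitOff π a i s → s ≡ b
      ≡b i∈ i≢a (inj₁ refl) = only-b i∈ i≢a
      ≡b i∈ i≢a (inj₂ (s∈ , _ , s≢a)) = only-b (block-trans π i∈ s∈) s≢a

  isBond : (π : BondPartition (Γ V)) → IsBond (Γ V) (value π)
  isBond (π ,ᵣ [ p ]) = recompute (isBond? (Γ V) π) p

  ≢0̂⇒apex : (π : BondPartition (Γ V)) → π ≢ 0̂ → Apex V (value π)
  ≢0̂⇒apex π π≢0̂ =
    let i , j , j∈ , j∉ = ≢⇒separated {σ = value 0̂} {value π} (0̂-minimum π) (λ eq → π≢0̂ (sym (value-injective eq)))
    in apex V (isBond π) j∈ λ j≡i → j∉ (subst (_∈ block (value 0̂) i) (sym j≡i) (block-refl (value 0̂) i))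

  ∈-0̂⁻ : ∀ {i j} → j ∈ block (value 0̂) i → i ≡ j
  ∈-0̂⁻ = ∈-classes⁻ Fin._≟_ isEquivalence

  ∣0̂∣ : ∣ value 0̂ ∣ ≡ n
  ∣0̂∣ = ∣∣-allLeast (value 0̂) λ i j j∈ → ℕ.≤-reflexive (cong toℕ (∈-0̂⁻ j∈))

  -- An edge would put two vertices into one component, so only the empty graph qualifies.
  #IDForestsOnSingletons : + #IDForestsOnBlocks V (value 0̂) ≡ 1ℤ
  #IDForestsOnSingletons = #≡1 Ms (λ M → isIDForest? V (graph M) ×-dec components (graph M) ≟ᵖ value 0̂) emptyGraph
    (locallyID⇒idForest V (graph emptyGraph) (record
      { bridges = contra ; ⊆Γ = contra ; ¬broken = λ e → contra e }) ,
     partition-ext {σ = components (graph emptyGraph)} {value 0̂}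
       (λ j∈ → still (∈-components⁻ (graph emptyGraph) j∈))
       (λ j∈ → subst (λ j → j ∈ block (components (graph emptyGraph)) _) (∈-0̂⁻ j∈)
                 (block-refl (components (graph emptyGraph)) _)))
    λ M (_ , eq) → adjacency-ext {M = M} {emptyGraph}
      (λ {i} {j} e → contradiction e (irrefl (graph M) (∈-0̂⁻ (subst (λ σ → j ∈ block σ i) eq
        (∈-components⁺ (graph M) (e ◅ ε)))))) contra
    where
    contra : ∀ {A : Set} {i j} → Adj (graph (emptyGraph {n})) i j → A
    contra e = contradiction e ¬emptyGraph-adj
    still : ∀ {i j} → Star (Adj (graph (emptyGraph {n}))) i j → j ∈ block (value 0̂) i
    still ε       = block-refl (value 0̂) _
    still (e ◅ _) = contra e

  private
    s : BondPartition (Γ V) → ℤ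
    s π = -1ℤ ^ n * (-1ℤ ^ ∣ value π ∣ * + #IDForestsOnBlocks V (value π))

  μ≡ : ∀ π → μ 0̂ π ≡ -1ℤ ^ n * (-1ℤ ^ ∣ value π ∣ * + #IDForestsOnBlocks V (value π))
  μ≡ = μ-unique (Π (Γ V)) s s-0̂ s-∑
    where
    s-0̂ : s 0̂ ≡ 1ℤ
    s-0̂ = trans (cong₂ (λ k c → -1ℤ ^ n * (-1ℤ ^ k * c)) ∣0̂∣ #IDForestsOnSingletons)
      (trans (cong (λ c → -1ℤ ^ n * c) (ℤ.*-identityʳ (-1ℤ ^ n))) (-1^n*-1^n n))

    rearrange : ∀ l a b c → l * (a * (b * c)) ≡ (l * (a * b)) * c
    rearrange = solve-∀

    rearrange′ : ∀ l p a b → p * (l * (a * b)) ≡ a * ((p * l) * b)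
    rearrange′ = solve-∀

    s-∑ : ∀ π → π ≢ 0̂ → ∑ℤ (elements enumeration) (λ σ → ⟦ σ ≤? π ⟧ * s σ) ≡ 0ℤ
    s-∑ π π≢0̂ = trans (∑-cong (elements enumeration) (λ σ →
        rearrange ⟦ σ ≤? π ⟧ (-1ℤ ^ n) (-1ℤ ^ ∣ value σ ∣) (+ #IDForestsOnBlocks V (value σ))))
      -- The sum over `σ ≤ π` becomes a signed sum over forests; the conditions on forest and order
      -- then combine into `IDForestWithin π`.
      (trans (∑-bonds V (λ σ → ⟦ σ ≤ᵖ? value π ⟧ * (-1ℤ ^ n * -1ℤ ^ ∣ σ ∣)))
      (trans (∑-cong (elements Ms) (λ M → trans
          (rearrange′ ⟦ components (graph M) ≤ᵖ? value π ⟧ ⟦ isIDForest? V (graph M) ⟧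
            (-1ℤ ^ n) (-1ℤ ^ ∣ components (graph M) ∣))
          (cong (λ c → -1ℤ ^ n * (c * -1ℤ ^ ∣ components (graph M) ∣))
            (sym (⟦⟧-× (isIDForest? V (graph M)) (components (graph M) ≤ᵖ? value π))))))
      (trans (∑-*ˡ (-1ℤ ^ n) (elements Ms) _)
      (trans (cong (λ c → -1ℤ ^ n * c) (∑-within≡0 V (≢0̂⇒apex π π≢0̂)))
        (ℤ.*-zeroʳ (-1ℤ ^ n))))))

  rk≡ : ∀ π → rk π ≡ n ∸ ∣ value π ∣
  rk≡ = rk-unique (Π (Γ V)) (λ π → n ∸ ∣ value π ∣)
    (λ {σ} {π} (σ≤π , σ≢π) → ℕ.∸-monoʳ-<
      (∣∣-antitone {σ = value σ} {value π} σ≤π (σ≢π ∘ value-injective)) (∣∣≤n (value σ)))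
    λ π → cover π (π ≟ 0̂)
    where
    cover : ∀ π → Dec (π ≡ 0̂) → n ∸ ∣ value π ∣ ≡ 0 ⊎
            (∃ λ σ → FinitePoset._<_ (Π (Γ V)) σ π × n ∸ ∣ value π ∣ ≡ suc (n ∸ ∣ value σ ∣))
    cover π (yes refl) = inj₁ (trans (cong (n ∸_) ∣0̂∣) (ℕ.n∸n≡0 n))
    cover π (no π≢0̂) = let σ , bond , σ≤π , eq = bond-cover (isBond π) (≢0̂⇒apex π π≢0̂) in
      inj₂ ((σ ,ᵣ [ bond ]) , (σ≤π , λ σ≡π → ℕ.1+n≢n (trans (sym eq) (cong (λ σ → ∣ value σ ∣) σ≡π))) ,
        -- `n ∸ k` is `suc n ∸ suc k` by definition, and the successor leaves the truncated
        -- subtraction because `suc ∣ value π ∣ ≡ ∣ σ ∣` is at most `n`.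
        trans (ℕ.+-∸-assoc 1 (subst (ℕ._≤ n) eq (∣∣≤n σ))) (cong (λ k → suc (n ∸ k)) (sym eq)))

  μ-idForestsOnBlocks : (π : BondPartition (Γ V)) →
          -1ℤ ^ n * (-1ℤ ^ ∣ value π ∣ * μ 0̂ π) ≡ + #IDForestsOnBlocks V (value π)
  μ-idForestsOnBlocks π = trans (cong (λ m → -1ℤ ^ n * (-1ℤ ^ ∣ value π ∣ * m)) (μ≡ π))
    (cancel-signs (-1ℤ ^ n) (-1ℤ ^ ∣ value π ∣) _ (-1^n*-1^n n) (-1^n*-1^n ∣ value π ∣))
    where
    rearrange : ∀ a b c → a * (b * (a * (b * c))) ≡ (a * a) * ((b * b) * c)
    rearrange = solve-∀
    cancel-signs : ∀ a b c → a * a ≡ 1ℤ → b * b ≡ 1ℤ → a * (b * (a * (b * c))) ≡ c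
    cancel-signs a b c a²≡1 b²≡1 = trans (rearrange a b c) (trans
      (cong₂ (λ x y → x * (y * c)) a²≡1 b²≡1) (trans (ℤ.*-identityˡ _) (ℤ.*-identityˡ c)))

  -- Position `i` stands for `suc (toℕ i)` trees, giving an index set for the tree counts from 1 to
  -- `n`.
  positions : Enumeration (Fin n)
  positions = record { elements = allFin n ; complete = ∈ₗ.∈-allFin ; unique = Unique.allFin⁺ n }

  -- ID trees and the characteristic polynomial for connected Γ

  module _ (connected : Connected (Γ V)) where

    private
      root : Fin n
      root = proj₁ (proj₁ connected)

    ∈-1̂ : ∀ {i j} → j ∈ block (components (Γ V)) i
    ∈-1̂ = ∈-components⁺ (Γ V) (Star.map (proj₂ ∘ proj₂) (proj₂ connected _ _ Subset.∈⊤ Subset.∈⊤))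

    ∣1̂∣ : ∣ value (1̂ (Γ V)) ∣ ≡ 1
    ∣1̂∣ = ℕ.≤-antisym (∣∣≤1 (components (Γ V)) λ i j → ∈-1̂) (1≤∣∣ (components (Γ V)) root)

    #IDForestsOnBlocks-1̂ : #IDForestsOnBlocks V (value (1̂ (Γ V))) ≡ #IDTrees V
    #IDForestsOnBlocks-1̂ = #-cong Ms
      (λ M → isIDForest? V (graph M) ×-dec components (graph M) ≟ᵖ components (Γ V))
      (λ T → isIDTree? V (adj? (graph T)) ⊤) forest⇒tree tree⇒forest
      where
      forest⇒tree : ∀ M → IsIDForest V (graph M) × components (graph M) ≡ components (Γ V) →
                    IsIDTree V (Adj (graph M)) ⊤
      forest⇒tree M (forest , eq) = locallyID⇒idTree V (symm (graph M)) (irrefl (graph M))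
        (proj₁ connected , λ u v _ _ → Star.map (λ e → Subset.∈⊤ , Subset.∈⊤ , e)
          (∈-components⁻ (graph M) (subst (λ σ → v ∈ block σ u) (sym eq) ∈-1̂)))
        (locallyID-⊆ V (proj₂ ∘ proj₂) (idForest⇒locallyID V (graph M) forest))

      tree⇒forest : ∀ M → IsIDTree V (Adj (graph M)) ⊤ →
                    IsIDForest V (graph M) × components (graph M) ≡ components (Γ V)
      tree⇒forest M tree@(((_ , reach) , _) , _) =
        locallyID⇒idForest V (graph M) (locallyID-⊆ V (λ e → Subset.∈⊤ , Subset.∈⊤ , e)
          (idTree⇒locallyID V (symm (graph M)) (irrefl (graph M)) tree)) ,
        partition-ext {σ = components (graph M)} {components (Γ V)} (λ _ → ∈-1̂)
          (λ _ → ∈-components⁺ (graph M) (Star.map (proj₂ ∘ proj₂) (reach _ _ Subset.∈⊤ Subset.∈⊤)))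

    μ-idTrees : -1ℤ ^ n * (- μ 0̂ (1̂ (Γ V))) ≡ + #IDTrees V
    μ-idTrees = trans (cong (λ m → -1ℤ ^ n * m) (sym (trans (cong (λ k → -1ℤ ^ k * μ 0̂ (1̂ (Γ V))) ∣1̂∣)
        (ℤ.-1*i≡-i (μ 0̂ (1̂ (Γ V)))))))
      (trans (μ-idForestsOnBlocks (1̂ (Γ V))) (cong +_ #IDForestsOnBlocks-1̂))

    -- The rank is largest at `1̂`: no partition of a nonempty set has fewer than one block, and by
    -- connectedness `1̂` has exactly one.
    ℓ≡ : ℓ ≡ n ∸ 1
    ℓ≡ = ℕ.≤-antisym
      (maximum-≤ (elements enumeration) λ π → subst (ℕ._≤ n ∸ 1) (sym (rk≡ π))
        (ℕ.∸-monoʳ-≤ n (1≤∣∣ (value π) root)))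
      (subst (ℕ._≤ ℓ) (trans (rk≡ (1̂ (Γ V))) (cong (n ∸_) ∣1̂∣))
        (maximum-≥ rk (complete enumeration (1̂ (Γ V)))))

    ℓ∸rk≡ : ∀ π → ℓ ∸ rk π ≡ ∣ value π ∣ ∸ 1
    -- The two subtractions from `n` change places, so that the double complement
    -- `n ∸ (n ∸ ∣ value π ∣)` collapses.
    ℓ∸rk≡ π = trans (cong₂ _∸_ ℓ≡ (rk≡ π)) (trans (trans (ℕ.∸-+-assoc n 1 (n ∸ ∣ value π ∣)) (trans (cong (n ∸_) (ℕ.+-comm 1 (n ∸ ∣ value π ∣))) (sym (ℕ.∸-+-assoc n (n ∸ ∣ value π ∣) 1))))
      (cong (_∸ 1) (ℕ.m∸[m∸n]≡n (∣∣≤n (value π)))))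

    -- Sign and exponent depend on `π` only through its number of blocks. The sum over bond
    -- partitions is therefore expanded into a sum over ID forests and collected again by number of
    -- trees.
    χ-idForestsWithTrees : χ ≗ ∑ₚ (map suc (upTo n))
              (λ k → (-1ℤ ^ n * (-1ℤ ^ k * + #IDForestsWithTrees V k)) ·t^ (k ∸ 1))
    χ-idForestsWithTrees m = begin
      χ m
        ≡⟨ ∑-cong (elements enumeration) (λ π → term ∣ value π ∣ (+ #IDForestsOnBlocks V (value π)) (ℓ∸rk≡ π) (μ≡ π)) ⟩
      ∑ℤ (elements enumeration) (λ π → coefficient ∣ value π ∣ * + #IDForestsOnBlocks V (value π))
        ≡⟨ ∑-bonds V (λ π → coefficient ∣ π ∣) ⟩
      ∑ℤ (elements Ms) (λ M → ⟦ isIDForest? V (graph M) ⟧ * coefficient ∣ components (graph M) ∣)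
        ≡⟨ ∑-fibres positions Ms (λ M → isIDForest? V (graph M)) ℕ._≟_ (λ M → ∣ components (graph M) ∣)
             (suc ∘ toℕ) (Fin.toℕ-injective ∘ ℕ.suc-injective) (λ M _ → position (components (graph M))) coefficient ⟨
      ∑ℤ (allFin n) (λ i → coefficient (suc (toℕ i)) * + #IDForestsWithTrees V (suc (toℕ i)))
        ≡⟨ ∑-cong (allFin n) (λ i → sym (term (suc (toℕ i)) (+ #IDForestsWithTrees V (suc (toℕ i))) refl refl)) ⟩
      ∑ℤ (allFin n) (λ i → summand (suc (toℕ i)))
        ≡⟨ ∑-map (suc ∘ toℕ) (allFin n) summand ⟨
      ∑ℤ (map (suc ∘ toℕ) (allFin n)) summand
        ≡⟨ cong (λ ks → ∑ℤ ks summand) (trans (List.map-∘ (allFin n)) (cong (map suc) map-toℕ-allFin)) ⟩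
      ∑ℤ (map suc (upTo n)) summand
        ∎
      where
      open ≡-Reasoning
      coefficient : ℕ → ℤ
      coefficient k = ⟦ k ∸ 1 ℕ.≟ m ⟧ * (-1ℤ ^ n * -1ℤ ^ k)

      summand : ℕ → ℤ
      summand k = ((-1ℤ ^ n * (-1ℤ ^ k * + #IDForestsWithTrees V k)) ·t^ (k ∸ 1)) m

      reassociate : ∀ p a b c → p * (a * (b * c)) ≡ (p * (a * b)) * c
      reassociate = solve-∀

      term : ∀ {c e} k x → e ≡ k ∸ 1 → c ≡ -1ℤ ^ n * (-1ℤ ^ k * x) → (c ·t^ e) m ≡ coefficient k * x
      term k x refl refl = trans (·t^-coefficient (-1ℤ ^ n * (-1ℤ ^ k * x)) (k ∸ 1) m)
        (reassociate ⟦ k ∸ 1 ℕ.≟ m ⟧ (-1ℤ ^ n) (-1ℤ ^ k) x)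

      -- The vertex `root` excludes zero blocks, so every count is a successor.
      position : ∀ π → ∃ λ (i : Fin n) → suc (toℕ i) ≡ ∣ π ∣
      position π with ∣ π ∣ | 1≤∣∣ π root | ∣∣≤n π
      ... | suc k | _ | k<n = Fin.fromℕ< k<n , cong suc (Fin.toℕ-fromℕ< k<n)

      map-toℕ-allFin : map toℕ (allFin n) ≡ upTo n
      map-toℕ-allFin = trans (List.map-tabulate id toℕ) (go n id)
        where
        go : ∀ m (f : ℕ → ℕ) → List.tabulate (λ (i : Fin m) → f (toℕ i)) ≡ applyUpTo f m
        go zero    f = refl
        go (suc m) f = cong (f 0 ∷_) (go m (f ∘ suc))

theorem3p5 : (V : PositiveSet) → let open FinitePoset (Π (Γ V)) in
    ((π : BondPartition (Γ V)) →
    -1ℤ ^ size V * (-1ℤ ^ ∣ value π ∣ * μ 0̂ π) ≡ + #IDForestsOnBlocks V (value π))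
    × (Connected (Γ V) →
    (-1ℤ ^ size V * (- μ 0̂ (1̂ (Γ V))) ≡ + #IDTrees V)
    × (χ ≗ ∑ₚ (map suc (upTo (size V)))
    (λ k → (-1ℤ ^ size V * (-1ℤ ^ k * + #IDForestsWithTrees V k)) ·t^ (k ∸ 1))))
theorem3p5 V = μ-idForestsOnBlocks V , λ connected → μ-idTrees V connected , χ-idForestsWithTrees V connected
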